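{- For every integer $d \geq 2$, there exists an algorithm for the problem $\mathrm{Schrijver}(n,k,m)$ (in the black-box input model) with $m < d \cdot \left\lfloor \frac{n}{2k+d-2} \right\rfloor$ whose running time is $n^{O(d)}$.
   Context: Write $[n]=\{1,2,\ldots,n\}$. A subset of $[n]$ is called stable if it contains no two consecutive elements and does not contain both $1$ and $n$ (equivalently, it is an independent set in the cycle on vertex set $[n]$ with the natural cyclic order). Let $\binom{[n]}{k}_{\mathrm{stab}}$ denote the family of stable $k$-subsets of $[n]$. For positive integers $n \geq 2k$, the Schrijver graph $S(n,k)$ has vertex set $\binom{[n]}{k}_{\mathrm{stab}}$, with two sets adjacent if and only if they are disjoint. For a function $m=m(n,k)$, the search problem $\mathrm{Schrijver}(n,k,m)$ is: the input consists of positive integers $n,k$ with $n\geq 2k$ and a coloring $c:\binom{[n]}{k}_{\mathrm{stab}} \to [m]$ (not necessarily proper) with $m=m(n,k)$ colors; the goal is to find a monochromatic edge of $S(n,k)$, i.e., $A,B\in\binom{[n]}{k}_{\mathrm{stab}}$ with $A\cap B=\emptyset$ and $c(A)=c(B)$. In the black-box input model, the coloring $c$ is given by an oracle which, given a vertex $A$, returns $c(A)$; each oracle query counts as a step of the running time. -}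

module Defs where

open import Data.Bool using (Bool; true; false)
open import Data.Fin using (Fin; zero; toℕ)
open import Data.Fin.Subset using (Subset; _∈_; _∩_; ∣_∣; Empty)
open import Data.Nat using (ℕ; zero; suc; _+_; _*_; _∸_; _≤_; NonZero)
open import Data.Nat.Properties using (+-∸-assoc)
open import Data.Product using (Σ; _×_)
open import Data.Vec using (Vec; []; _∷_; lookup; replicate; _[_]≔_)
open import Relation.Binary.PropositionalEquality using (_≡_; _≢_; subst; sym)
open import Relation.Nullary using (¬_)

------------------------------------------------------------------------
-- Schrijver graphs

-- The element i of {1,…,n} is represented by the i' : Fin n with
-- toℕ i' ≡ i - 1.
record Stable {n : ℕ} (A : Subset n) : Set where
  field
    noConsecutive   : ∀ (i j : Fin n) → i ∈ A → j ∈ A → toℕ j ≢ suc (toℕ i)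
    notFirstAndLast : ∀ (i j : Fin n) → toℕ i ≡ 0 → suc (toℕ j) ≡ n →
                      ¬ (i ∈ A × j ∈ A)

-- The proofs are irrelevant so that a vertex is determined by its
-- underlying set; in particular a colouring depends on nothing else.
record Vertex (n k : ℕ) : Set where
  constructor vertex
  field
    set     : Subset n
    .stable : Stable set
    .size   : ∣ set ∣ ≡ k

open Vertex public

Adjacent : ∀ {n k} → Vertex n k → Vertex n k → Set
Adjacent A B = Empty (set A ∩ set B)

-- Arbitrary, not necessarily proper, colourings.
Colouring : (n k m : ℕ) → Set
Colouring n k m = Vertex n k → Fin m

record MonochromaticEdge {n k m : ℕ} (c : Colouring n k m) : Set where
  constructor monochromaticEdge
  field
    left right : Vertex n k
    adjacent   : Adjacent left right
    sameColour : c left ≡ c right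

------------------------------------------------------------------------
-- Oracle programs
--
-- The model of computation is Jones's WHILE language (binary trees as
-- data, finitely many variables, unit-cost tree operations) extended with
-- oracle calls.  Without the oracle it is polynomially equivalent to
-- Turing machines.

infixr 5 _∙_

data Tree : Set where
  nil : Tree
  _∙_ : Tree → Tree → Tree

head tail : Tree → Tree
head nil     = nil
head (s ∙ t) = s
tail nil     = nil
tail (s ∙ t) = t

data Expr (v : ℕ) : Set where
  var   : Fin v → Expr v
  quot  : Tree → Expr v
  cons  : Expr v → Expr v → Expr v
  hd tl : Expr v → Expr v

infix  4 _:=_ _:=query_
infixr 3 _⨾_

data Cmd (v : ℕ) : Set where
  _:=_          : Fin v → Expr v → Cmd v
  _:=query_     : Fin v → Expr v → Cmd v
  _⨾_           : Cmd v → Cmd v → Cmd v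
  if_then_else_ : Expr v → Cmd v → Cmd v → Cmd v
  while_loop_     : Expr v → Cmd v → Cmd v

Store : ℕ → Set
Store v = Vec Tree v

eval : ∀ {v} → Expr v → Store v → Tree
eval (var x)    σ = lookup σ x
eval (quot t)   σ = t
eval (cons e f) σ = eval e σ ∙ eval f σ
eval (hd e)     σ = head (eval e σ)
eval (tl e)     σ = tail (eval e σ)

cost : ∀ {v} → Expr v → ℕ
cost (var x)    = 1
cost (quot t)   = 1
cost (cons e f) = 1 + cost e + cost f
cost (hd e)     = 1 + cost e
cost (tl e)     = 1 + cost e

-- O q a: the oracle replies a to the query q.  A query with no reply
-- blocks the execution.
Oracle : Set₁
Oracle = Tree → Tree → Set

-- O ⊢ p , σ ⇓ τ [ t ]: with oracle O, the command p started in store σ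
-- halts in store τ after t steps.  In tests, nil is false and every other
-- tree is true.
infix 2 _⊢_,_⇓_[_]

data _⊢_,_⇓_[_] {v : ℕ} (O : Oracle) :
       Cmd v → Store v → Store v → ℕ → Set where

  assign : ∀ {x e σ} →
           O ⊢ (x := e) , σ ⇓ σ [ x ]≔ eval e σ [ 1 + cost e ]

  query : ∀ {x e σ a} → O (eval e σ) a →
          O ⊢ (x :=query e) , σ ⇓ σ [ x ]≔ a [ 1 + cost e ]

  seq : ∀ {p q σ τ υ s t} →
        O ⊢ p , σ ⇓ τ [ s ] → O ⊢ q , τ ⇓ υ [ t ] →
        O ⊢ (p ⨾ q) , σ ⇓ υ [ s + t ]

  if-true : ∀ {e p q σ τ t} → eval e σ ≢ nil →
            O ⊢ p , σ ⇓ τ [ t ] →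
            O ⊢ (if e then p else q) , σ ⇓ τ [ 1 + cost e + t ]

  if-false : ∀ {e p q σ τ t} → eval e σ ≡ nil →
             O ⊢ q , σ ⇓ τ [ t ] →
             O ⊢ (if e then p else q) , σ ⇓ τ [ 1 + cost e + t ]

  while-true : ∀ {e p σ τ υ s t} → eval e σ ≢ nil →
               O ⊢ p , σ ⇓ τ [ s ] → O ⊢ (while e loop p) , τ ⇓ υ [ t ] →
               O ⊢ (while e loop p) , σ ⇓ υ [ 1 + cost e + s + t ]

  while-false : ∀ {e p σ} → eval e σ ≡ nil →
                O ⊢ (while e loop p) , σ ⇓ σ [ 1 + cost e ]

-- Input and output are passed in variable zero; the other variables are
-- initially nil.
record Program : Set where
  constructor program
  field
    {others} : ℕ
    body     : Cmd (suc others)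

record Computes (O : Oracle) (P : Program) (input output : Tree) (t : ℕ) : Set where
  open Program P
  field
    {rest} : Vec Tree others
    run    : O ⊢ body , (input ∷ replicate others nil) ⇓ (output ∷ rest) [ t ]

------------------------------------------------------------------------
-- The search problem in the black-box model

⌜_⌝ℕ : ℕ → Tree
⌜ zero ⌝ℕ  = nil
⌜ suc n ⌝ℕ = nil ∙ ⌜ n ⌝ℕ

⌜_⌝Bool : Bool → Tree
⌜ false ⌝Bool = nil
⌜ true ⌝Bool  = nil ∙ nil

-- A subset is given by its list of n membership bits.
⌜_⌝Subset : ∀ {n} → Subset n → Tree
⌜ [] ⌝Subset    = nil
⌜ b ∷ A ⌝Subset = ⌜ b ⌝Bool ∙ ⌜ A ⌝Subset

⌜_⌝Vertex : ∀ {n k} → Vertex n k → Tree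
⌜ A ⌝Vertex = ⌜ set A ⌝Subset

⌜_⌝Edge : ∀ {n k m} {c : Colouring n k m} → MonochromaticEdge c → Tree
⌜ e ⌝Edge = ⌜ left ⌝Vertex ∙ ⌜ right ⌝Vertex
  where open MonochromaticEdge e

-- Only vertices can be queried.  Distinct vertices have distinct encodings,
-- so the reply is unique.
oracle : ∀ {n k m} → Colouring n k m → Oracle
oracle {n} {k} c q a =
  Σ (Vertex n k) λ A → q ≡ ⌜ A ⌝Vertex × a ≡ ⌜ toℕ (c A) ⌝ℕ

-- Besides its access to c, the program is given only n and k.
record SolvesWithin (P : Program) {n k m : ℕ} (c : Colouring n k m) (bound : ℕ) : Set where
  field
    edge     : MonochromaticEdge c
    time     : ℕ
    computes : Computes (oracle c) P (⌜ n ⌝ℕ ∙ ⌜ k ⌝ℕ) ⌜ edge ⌝Edge time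
    inTime   : time ≤ bound

blockSize-nonZero : ∀ {d k} → 2 ≤ d → .{{_ : NonZero k}} → NonZero (2 * k + d ∸ 2)
blockSize-nonZero {k = suc k} 2≤d =
  subst NonZero (sym (+-∸-assoc (2 * suc k) 2≤d)) _

-- Cut {1,…,n} into N = ⌊n/(2k+d-2)⌋ blocks of 2k+d-2 consecutive elements.  A
-- colouring without monochromatic edge uses at least d colours on the stable
-- k-sets of a single block, and sets from different blocks are disjoint, so it
-- uses at least dN colours altogether.  It therefore suffices to query the
-- n^O(d) stable k-sets contained in a window of that length and to compare
-- them pairwise.
--
-- The lower bound for one block is Schrijver's theorem.  It is derived from the
-- following form of Fan's lemma: an odd function {0,+,-}ⁿ ∖ {0} → {+,-}
-- alternates along some maximal chain.  Working over 𝔽₂, let U sum a function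
-- over upper covers, so that U² = 0, and let W⁺ᵣ and W⁻ᵣ sum over the
-- alternating chains of length r starting with either sign.  Then
-- W⁺ᵣ₊₁ + W⁻ᵣ₊₁ = W⁺ᵣ U.  Applied in a hemisphere, this identity shows that the
-- number of alternating maximal chains has the same parity for n + 1 as for n.
-- A vector X is then given the sign of the part, positive or negative, that is
-- larger: in terms of the largest colour of a stable k-set it contains, if X
-- has 2k alternations of sign, and of its longest alternating sequence
-- otherwise.

module Submission where

open import Data.Bool as Bool using (Bool; true; false; not; _xor_; _∧_)
  renaming (T to IsTrue; if_then_else_ to ifᵇ_then_else_)
open import Data.Bool.Properties using (xor-same; ∧-zeroʳ; not-¬)
open import Data.Bool.Solver using (module xor-∧-Solver)
open import Data.Fin as Fin using (Fin; zero; suc; toℕ; #_; remQuot; combine)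
open import Data.Fin.Properties as Fin using (toℕ<n; toℕ-injective; pigeonhole; combine-remQuot)
open import Data.Fin.Subset using (_∈_; _∉_; ∣_∣; _∩_; Empty)
open import Data.List using (List; []; _∷_; length; replicate; _++_)
open import Data.List.Membership.Propositional using (lose) renaming (_∈_ to _∈ˡ_)
open import Data.List.Properties using (length-replicate; ≡-dec)
open import Data.List.Relation.Binary.Pointwise as Pointwise using (Pointwise; []; _∷_)
open import Data.List.Relation.Unary.Any using (Any; here; there; any?)
open import Data.Maybe as Maybe using (Maybe; just; nothing)
open import Data.Nat hiding (compare)
open import Data.Nat.DivMod using (m/n*n≤m; m/n≤m)
open import Data.Nat.Properties
open import Data.Nat.Solver using (module +-*-Solver)
open import Data.Product using (_×_; _,_; ∃; ∃-syntax; proj₁; proj₂)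
open import Data.Sum using (_⊎_; inj₁; inj₂)
open import Data.Vec as Vec using (Vec; []; _∷_; toList; fromList)
open import Data.Vec.Properties using (toList∘fromList; length-toList)
open import Function using (_∘_; id)
open import Relation.Binary using (tri<; tri≈; tri>)
open import Relation.Binary.PropositionalEquality
open import Relation.Nullary using (¬_; Dec; yes; no; contradiction; _×-dec_)
open import Defs

open +-*-Solver using (solve; con; _:+_; _:*_) renaming (_:=_ to _:≡_)
open xor-∧-Solver using ()
  renaming (solve to solve₂; con to con₂; _:+_ to _⊕_; _:*_ to _⊗_; _:=_ to _:≡₂_)


-- Alternating chains over 𝔽₂, for an operator of square zero

module Alternation {A : Set} (U : (A → Bool) → A → Bool)
  (U-cong : ∀ {f g} → (∀ y → f y ≡ g y) → ∀ x → U f x ≡ U g x)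
  (U-xor : ∀ f g x → U (λ y → f y xor g y) x ≡ U f x xor U g x)
  (U² : ∀ f x → U (U f) x ≡ false)
  where

  -- ε is the sign opposite to the one at which the chain starts.
  alternating : (A → Bool) → Bool → ℕ → (A → Bool) → A → Bool
  alternating s ε zero    f = f
  alternating s ε (suc r) f = U λ y → (s y xor ε) ∧ alternating s (not ε) r f y

  alternating-cong : ∀ s ε r {f g} → (∀ y → f y ≡ g y) →
                     ∀ x → alternating s ε r f x ≡ alternating s ε r g x
  alternating-cong s ε zero    f≡g = f≡g
  alternating-cong s ε (suc r) f≡g =
    U-cong λ y → cong ((s y xor ε) ∧_) (alternating-cong s (not ε) r f≡g y)

  -- The two sign tests on the first element of a chain add up to 1. Beyond the base case the
  -- continuations `p` and `q` therefore combine to `q` plus the first test times `p` + `q`. Here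
  -- `U q` vanishes, since `q` is itself a value of `U`, and the induction rewrites `p` + `q`.
  alternating-sum : ∀ s ε r f x →
    alternating s ε (suc r) f x xor alternating s (not ε) (suc r) f x ≡
    alternating s ε r (U f) x
  alternating-sum s ε zero f x =
    trans (sym (U-xor _ _ x)) (U-cong (λ y → split (s y) ε (f y)) x)
    where
    split : ∀ a e p → ((a xor e) ∧ p) xor ((a xor not e) ∧ p) ≡ p
    split = solve₂ 3 (λ a e p →
      (a ⊕ e) ⊗ p ⊕ (a ⊕ (con₂ true ⊕ e)) ⊗ p :≡₂ p) refl
  alternating-sum s ε (suc r) f x = begin
    U (λ y → (s y xor ε) ∧ p y) x xor U (λ y → (s y xor not ε) ∧ q y) x
      ≡⟨ U-xor _ _ x ⟨
    U (λ y → ((s y xor ε) ∧ p y) xor ((s y xor not ε) ∧ q y)) x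
      ≡⟨ U-cong (λ y → regroup (s y) ε (alternating-sum s (not ε) r f y)) x ⟩
    U (λ y → q y xor ((s y xor ε) ∧ alternating s (not ε) r (U f) y)) x
      ≡⟨ U-xor _ _ x ⟩
    U q x xor alternating s ε (suc r) (U f) x
      ≡⟨ cong (_xor alternating s ε (suc r) (U f) x) (U² _ x) ⟩
    alternating s ε (suc r) (U f) x ∎
    where
    open ≡-Reasoning
    p q : A → Bool
    p = alternating s (not ε) (suc r) f
    q = alternating s (not (not ε)) (suc r) f
    regroup : ∀ a e {p q b} → p xor q ≡ b →
              ((a xor e) ∧ p) xor ((a xor not e) ∧ q) ≡ q xor ((a xor e) ∧ b)
    regroup a e {p} {q} refl = solve₂ 4 (λ a e p q →
      (a ⊕ e) ⊗ p ⊕ (a ⊕ (con₂ true ⊕ e)) ⊗ q :≡₂ q ⊕ (a ⊕ e) ⊗ (p ⊕ q))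
      refl a e p q

-- Fan's lemma for odd functions of sign vectors

SignVec : ℕ → Set
SignVec n = Vec (Maybe Bool) n

origin : ∀ {n} → SignVec n
origin = Vec.replicate _ nothing

neg : ∀ {n} → SignVec n → SignVec n
neg = Vec.map (Maybe.map not)

data Nonzero : ∀ {n} → SignVec n → Set where
  here  : ∀ {n ε} {X : SignVec n} → Nonzero (just ε ∷ X)
  there : ∀ {n x} {X : SignVec n} → Nonzero X → Nonzero (x ∷ X)

full : ∀ {n} → SignVec n → Bool
full []            = true
full (nothing ∷ X) = false
full (just _ ∷ X)  = full X

-- The sum, over 𝔽₂, of f over the upper covers of a sign vector.
up : ∀ {n} → (SignVec n → Bool) → SignVec n → Bool
up f []            = false
up f (just ε ∷ X)  = up (f ∘ (just ε ∷_)) X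
up f (nothing ∷ X) =
  up (f ∘ (nothing ∷_)) X xor (f (just true ∷ X) xor f (just false ∷ X))

-- The origin is never an upper cover. This form matters because oddness is assumed for nonzero
-- vectors only.
up-cong⁺ : ∀ {n} {f g : SignVec n → Bool} →
           (∀ Y → Nonzero Y → f Y ≡ g Y) → ∀ X → up f X ≡ up g X
up-cong⁺ f≡g []            = refl
up-cong⁺ f≡g (just ε ∷ X)  = up-cong⁺ (λ Y _ → f≡g (just ε ∷ Y) here) X
up-cong⁺ f≡g (nothing ∷ X) = cong₂ _xor_
  (up-cong⁺ (λ Y p → f≡g (nothing ∷ Y) (there p)) X)
  (cong₂ _xor_ (f≡g (just true ∷ X) here) (f≡g (just false ∷ X) here))

up-cong : ∀ {n} {f g : SignVec n → Bool} →
          (∀ Y → f Y ≡ g Y) → ∀ X → up f X ≡ up g X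
up-cong f≡g = up-cong⁺ (λ Y _ → f≡g Y)

up-xor : ∀ {n} (f g : SignVec n → Bool) X →
         up (λ Y → f Y xor g Y) X ≡ up f X xor up g X
up-xor f g []            = refl
up-xor f g (just ε ∷ X)  = up-xor _ _ X
up-xor f g (nothing ∷ X) = trans
  (cong₂ _xor_ (up-xor (f ∘ (nothing ∷_)) (g ∘ (nothing ∷_)) X) refl)
  (solve₂ 6 (λ a b c d e f →
    (a ⊕ b) ⊕ ((c ⊕ d) ⊕ (e ⊕ f)) :≡₂ (a ⊕ (c ⊕ e)) ⊕ (b ⊕ (d ⊕ f))) refl
    (up (f ∘ (nothing ∷_)) X) (up (g ∘ (nothing ∷_)) X) (f (just true ∷ X)) (g (just true ∷ X))
    (f (just false ∷ X)) (g (just false ∷ X)))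

-- An interval of length two in the order of sign vectors has exactly two middle elements, so every
-- term occurs twice.
up² : ∀ {n} (f : SignVec n → Bool) X → up (up f) X ≡ false
up² f []            = refl
up² f (just ε ∷ X)  = up² (f ∘ (just ε ∷_)) X
up² f (nothing ∷ X) = begin
  up (λ Y → up f⁰ Y xor (f⁺ Y xor f⁻ Y)) X xor (up f⁺ X xor up f⁻ X)
    ≡⟨ cong₂ _xor_ (up-xor (up f⁰) (λ Y → f⁺ Y xor f⁻ Y) X) refl ⟩
  (up (up f⁰) X xor up (λ Y → f⁺ Y xor f⁻ Y) X) xor (up f⁺ X xor up f⁻ X)
    ≡⟨ cong₂ _xor_ (cong₂ _xor_ (up² f⁰ X) (up-xor f⁺ f⁻ X)) refl ⟩
  (up f⁺ X xor up f⁻ X) xor (up f⁺ X xor up f⁻ X)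
    ≡⟨ xor-same (up f⁺ X xor up f⁻ X) ⟩
  false ∎
  where
  open ≡-Reasoning
  f⁰ = f ∘ (nothing ∷_)
  f⁺ = f ∘ (just true ∷_)
  f⁻ = f ∘ (just false ∷_)

-- The sum over the upper covers within a closed hemisphere: (false , X) stands
-- for the point X of the equator and (true , X) for the point X above it.
hemiUp : ∀ {n} → (Bool × SignVec n → Bool) → Bool × SignVec n → Bool
hemiUp f (true  , X) = up (f ∘ (true ,_)) X
hemiUp f (false , X) = up (f ∘ (false ,_)) X xor f (true , X)

hemiUp-cong : ∀ {n} {f g : Bool × SignVec n → Bool} →
              (∀ y → f y ≡ g y) → ∀ x → hemiUp f x ≡ hemiUp g x
hemiUp-cong f≡g (true  , X) = up-cong (λ Y → f≡g (true , Y)) X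
hemiUp-cong f≡g (false , X) =
  cong₂ _xor_ (up-cong (λ Y → f≡g (false , Y)) X) (f≡g (true , X))

hemiUp-xor : ∀ {n} (f g : Bool × SignVec n → Bool) x →
             hemiUp (λ y → f y xor g y) x ≡ hemiUp f x xor hemiUp g x
hemiUp-xor f g (true  , X) = up-xor _ _ X
hemiUp-xor f g (false , X) = trans
  (cong₂ _xor_ (up-xor (f ∘ (false ,_)) (g ∘ (false ,_)) X) refl)
  (solve₂ 4 (λ a b c d → (a ⊕ b) ⊕ (c ⊕ d) :≡₂ (a ⊕ c) ⊕ (b ⊕ d)) refl
    (up (f ∘ (false ,_)) X) (up (g ∘ (false ,_)) X) (f (true , X)) (g (true , X)))

hemiUp² : ∀ {n} (f : Bool × SignVec n → Bool) x → hemiUp (hemiUp f) x ≡ false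
hemiUp² f (true  , X) = up² (f ∘ (true ,_)) X
hemiUp² f (false , X) = begin
  up (λ Y → up (f ∘ (false ,_)) Y xor f (true , Y)) X xor up (f ∘ (true ,_)) X
    ≡⟨ cong₂ _xor_ (up-xor (up (f ∘ (false ,_))) (f ∘ (true ,_)) X) refl ⟩
  (up (up (f ∘ (false ,_))) X xor up (f ∘ (true ,_)) X) xor up (f ∘ (true ,_)) X
    ≡⟨ cong (λ b → (b xor up (f ∘ (true ,_)) X) xor up (f ∘ (true ,_)) X) (up² (f ∘ (false ,_)) X) ⟩
  up (f ∘ (true ,_)) X xor up (f ∘ (true ,_)) X
    ≡⟨ xor-same (up (f ∘ (true ,_)) X) ⟩
  false ∎
  where open ≡-Reasoning

module Sphere {n : ℕ} = Alternation (up {n}) up-cong up-xor up²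
module Hemisphere {n : ℕ} = Alternation (hemiUp {n}) hemiUp-cong hemiUp-xor hemiUp²

-- The two hemispheres and the parity of alternating maximal chains

embed : ∀ {n} → Bool → Bool × SignVec n → SignVec (suc n)
embed δ (false , X) = nothing ∷ X
embed δ (true  , X) = just δ ∷ X

reflect : ∀ {n} → Bool × SignVec n → Bool × SignVec n
reflect (b , X) = b , neg X

neg-embed : ∀ {n} δ (x : Bool × SignVec n) → neg (embed δ x) ≡ embed (not δ) (reflect x)
neg-embed δ (false , X) = refl
neg-embed δ (true  , X) = refl

neg-origin : ∀ n → neg (origin {n}) ≡ origin
neg-origin zero    = refl
neg-origin (suc n) = cong (nothing ∷_) (neg-origin n)

up-neg : ∀ {n} (f : SignVec n → Bool) X → up (f ∘ neg) X ≡ up f (neg X)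
up-neg f []               = refl
up-neg f (just ε ∷ X)     = up-neg (f ∘ (just (not ε) ∷_)) X
up-neg f (nothing ∷ X) = cong₂ _xor_ (up-neg (f ∘ (nothing ∷_)) X)
  (solve₂ 2 (λ a b → a ⊕ b :≡₂ b ⊕ a) refl (f (just false ∷ neg X)) (f (just true ∷ neg X)))

full-neg : ∀ {n} (X : SignVec n) → full (neg X) ≡ full X
full-neg []            = refl
full-neg (nothing ∷ X) = refl
full-neg (just _ ∷ X)  = full-neg X

up-zero : ∀ {n} (X : SignVec n) → up (λ _ → false) X ≡ false
up-zero X = trans (up-xor (λ _ → false) (λ _ → false) X) (xor-same (up (λ _ → false) X))

-- A vector with a single zero entry has two full covers, and no other vector has any.
up-full : ∀ {n} (X : SignVec n) → up full X ≡ false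
up-full []            = refl
up-full (just _ ∷ X)  = up-full X
up-full (nothing ∷ X) = cong₂ _xor_ (up-zero X) (xor-same (full X))

hemiUp-reflect : ∀ {n} (f : Bool × SignVec n → Bool) x →
                 hemiUp (f ∘ reflect) x ≡ hemiUp f (reflect x)
hemiUp-reflect f (true  , X) = up-neg (f ∘ (true ,_)) X
hemiUp-reflect f (false , X) = cong (_xor f (true , neg X)) (up-neg (f ∘ (false ,_)) X)

hemiUp-cong⁺ : ∀ {n} δ {f g : Bool × SignVec n → Bool} →
               (∀ y → Nonzero (embed δ y) → f y ≡ g y) → ∀ x → hemiUp f x ≡ hemiUp g x
hemiUp-cong⁺ δ f≡g (true  , X) = up-cong (λ Y → f≡g (true , Y) here) X
hemiUp-cong⁺ δ f≡g (false , X) =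
  cong₂ _xor_ (up-cong⁺ (λ Y p → f≡g (false , Y) (there p)) X) (f≡g (true , X) here)

module _ {n : ℕ} (s : SignVec (suc n) → Bool) where

  alternating-above : ∀ δ ε r f X →
    Sphere.alternating s ε r f (just δ ∷ X) ≡
    Hemisphere.alternating (s ∘ embed δ) ε r (f ∘ embed δ) (true , X)
  alternating-above δ ε zero    f X = refl
  alternating-above δ ε (suc r) f X =
    up-cong (λ Y → cong ((s (just δ ∷ Y) xor ε) ∧_) (alternating-above δ (not ε) r f Y)) X

  -- A chain that stays in the equator is counted in both hemispheres.
  alternating-split : ∀ ε r f X →
    Sphere.alternating s ε r f (nothing ∷ X) ≡
    Sphere.alternating (s ∘ (nothing ∷_)) ε r (f ∘ (nothing ∷_)) X xor
    (Hemisphere.alternating (s ∘ embed true) ε r (f ∘ embed true) (false , X) xor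
     Hemisphere.alternating (s ∘ embed false) ε r (f ∘ embed false) (false , X))
  alternating-split ε zero f X =
    solve₂ 1 (λ a → a :≡₂ a ⊕ (a ⊕ a)) refl (f (nothing ∷ X))
  alternating-split ε (suc r) f X = begin
    up (λ Y → σ Y ∧ Sphere.alternating s (not ε) r f (nothing ∷ Y)) X xor
    (σ⁺ ∧ Sphere.alternating s (not ε) r f (just true ∷ X) xor
     σ⁻ ∧ Sphere.alternating s (not ε) r f (just false ∷ X))
      ≡⟨ cong₂ _xor_ onEquator
           (cong₂ (λ a b → σ⁺ ∧ a xor σ⁻ ∧ b)
             (alternating-above true (not ε) r f X) (alternating-above false (not ε) r f X)) ⟩
    (up (λ Y → σ Y ∧ E Y) X xor (up (λ Y → σ Y ∧ H⁺ (false , Y)) X xor up (λ Y → σ Y ∧ H⁻ (false , Y)) X)) xor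
    (σ⁺ ∧ H⁺ (true , X) xor σ⁻ ∧ H⁻ (true , X))
      ≡⟨ solve₂ 5 (λ a b c d e → (a ⊕ (b ⊕ c)) ⊕ (d ⊕ e) :≡₂ a ⊕ ((b ⊕ d) ⊕ (c ⊕ e))) refl
           (up (λ Y → σ Y ∧ E Y) X) (up (λ Y → σ Y ∧ H⁺ (false , Y)) X)
           (up (λ Y → σ Y ∧ H⁻ (false , Y)) X) (σ⁺ ∧ H⁺ (true , X)) (σ⁻ ∧ H⁻ (true , X)) ⟩
    up (λ Y → σ Y ∧ E Y) X xor
    ((up (λ Y → σ Y ∧ H⁺ (false , Y)) X xor σ⁺ ∧ H⁺ (true , X)) xor
     (up (λ Y → σ Y ∧ H⁻ (false , Y)) X xor σ⁻ ∧ H⁻ (true , X))) ∎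
    where
    open ≡-Reasoning
    σ  = λ Y → s (nothing ∷ Y) xor ε
    σ⁺ = s (just true ∷ X) xor ε
    σ⁻ = s (just false ∷ X) xor ε
    E  = Sphere.alternating (s ∘ (nothing ∷_)) (not ε) r (f ∘ (nothing ∷_))
    H⁺ = Hemisphere.alternating (s ∘ embed true) (not ε) r (f ∘ embed true)
    H⁻ = Hemisphere.alternating (s ∘ embed false) (not ε) r (f ∘ embed false)
    onEquator : up (λ Y → σ Y ∧ Sphere.alternating s (not ε) r f (nothing ∷ Y)) X ≡
                up (λ Y → σ Y ∧ E Y) X xor
                (up (λ Y → σ Y ∧ H⁺ (false , Y)) X xor up (λ Y → σ Y ∧ H⁻ (false , Y)) X)
    onEquator = begin
      up (λ Y → σ Y ∧ Sphere.alternating s (not ε) r f (nothing ∷ Y)) X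
        ≡⟨ up-cong (λ Y → trans (cong (σ Y ∧_) (alternating-split (not ε) r f Y))
             (solve₂ 4 (λ σ a b c → σ ⊗ (a ⊕ (b ⊕ c)) :≡₂ σ ⊗ a ⊕ (σ ⊗ b ⊕ σ ⊗ c))
               refl (σ Y) (E Y) (H⁺ (false , Y)) (H⁻ (false , Y)))) X ⟩
      up (λ Y → σ Y ∧ E Y xor (σ Y ∧ H⁺ (false , Y) xor σ Y ∧ H⁻ (false , Y))) X
        ≡⟨ up-xor _ _ X ⟩
      up (λ Y → σ Y ∧ E Y) X xor up (λ Y → σ Y ∧ H⁺ (false , Y) xor σ Y ∧ H⁻ (false , Y)) X
        ≡⟨ cong (up (λ Y → σ Y ∧ E Y) X xor_) (up-xor _ _ X) ⟩
      up (λ Y → σ Y ∧ E Y) X xor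
      (up (λ Y → σ Y ∧ H⁺ (false , Y)) X xor up (λ Y → σ Y ∧ H⁻ (false , Y)) X) ∎

  module _ (odd : ∀ X → Nonzero X → s (neg X) ≡ not (s X)) where

    -- Negation carries one hemisphere to the other, and by oddness it exchanges the two starting
    -- signs.
    alternating-reflect : ∀ ε r x →
      Hemisphere.alternating (s ∘ embed false) ε r (full ∘ embed false) x ≡
      Hemisphere.alternating (s ∘ embed true) (not ε) r (full ∘ embed true) (reflect x)
    alternating-reflect ε zero (true  , X) = sym (full-neg X)
    alternating-reflect ε zero (false , X) = refl
    alternating-reflect ε (suc r) x = trans
      (hemiUp-cong⁺ false (λ y p → cong₂ _∧_ (sign y p) (alternating-reflect (not ε) r y)) x)
      (hemiUp-reflect _ x)
      where
      flip : ∀ a b e → b ≡ not a → a xor e ≡ b xor not e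
      flip false _ false refl = refl
      flip false _ true  refl = refl
      flip true  _ false refl = refl
      flip true  _ true  refl = refl
      sign : ∀ y → Nonzero (embed false y) →
             s (embed false y) xor ε ≡ s (embed true (reflect y)) xor not ε
      sign y p = flip (s (embed false y)) _ ε
        (trans (cong s (sym (neg-embed false y))) (odd (embed false y) p))

-- A chain that leaves the equator never returns to it, so it ends where `f` vanishes.
alternating-equator : ∀ {n} (s : Bool × SignVec n → Bool) ε r f X → (∀ Y → f (true , Y) ≡ false) →
  Hemisphere.alternating s ε r f (false , X) ≡
  Sphere.alternating (s ∘ (false ,_)) ε r (f ∘ (false ,_)) X
alternating-equator s ε r f X f≡0 = go ε r X
  where
  xor-false : ∀ a {b} → b ≡ false → a xor b ≡ a
  xor-false false refl = refl
  xor-false true  refl = refl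
  above : ∀ ε r Y → Hemisphere.alternating s ε r f (true , Y) ≡ false
  above ε zero    Y = f≡0 Y
  above ε (suc r) Y = trans
    (up-cong (λ Z → trans (cong ((s (true , Z) xor ε) ∧_) (above (not ε) r Z)) (∧-zeroʳ _)) Y)
    (up-zero Y)
  go : ∀ ε r X → Hemisphere.alternating s ε r f (false , X) ≡
                 Sphere.alternating (s ∘ (false ,_)) ε r (f ∘ (false ,_)) X
  go ε zero    X = refl
  go ε (suc r) X = trans
    (xor-false _ (trans (cong ((s (true , X) xor ε) ∧_) (above (not ε) r X)) (∧-zeroʳ _)))
    (up-cong (λ Y → cong ((s (false , Y) xor ε) ∧_) (go (not ε) r Y)) X)

alternating-zero : ∀ {n} s ε r (X : SignVec n) → Sphere.alternating s ε r (λ _ → false) X ≡ false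
alternating-zero s ε zero    X = refl
alternating-zero s ε (suc r) X = trans
  (up-cong (λ Y → trans (cong ((s Y xor ε) ∧_) (alternating-zero s (not ε) r Y)) (∧-zeroʳ _)) X)
  (up-zero X)

-- Parity form of Fan's lemma, by induction on the dimension. No chain inside the equator ends at a
-- full vector, and reflection turns the second hemisphere into the first with the other starting
-- sign, so `alternating-sum` removes one step.
alternating-full : ∀ n (s : SignVec n → Bool) → (∀ X → Nonzero X → s (neg X) ≡ not (s X)) →
                   ∀ ε → Sphere.alternating s ε n full origin ≡ true
alternating-full zero    s odd ε = refl
alternating-full (suc n) s odd ε = begin
  Sphere.alternating s ε (suc n) full (nothing ∷ origin)
    ≡⟨ alternating-split s ε (suc n) full origin ⟩
  Sphere.alternating (s ∘ (nothing ∷_)) ε (suc n) (λ _ → false) origin xor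
  (H⁺ ε (false , origin) xor
   Hemisphere.alternating (s ∘ embed false) ε (suc n) (full ∘ embed false) (false , origin))
    ≡⟨ cong₂ _xor_ (alternating-zero (s ∘ (nothing ∷_)) ε (suc n) origin)
         (cong (H⁺ ε (false , origin) xor_) (trans
           (alternating-reflect s odd ε (suc n) (false , origin))
           (cong (λ X → H⁺ (not ε) (false , X)) (neg-origin n)))) ⟩
  H⁺ ε (false , origin) xor H⁺ (not ε) (false , origin)
    ≡⟨ Hemisphere.alternating-sum (s ∘ embed true) ε n (full ∘ embed true) (false , origin) ⟩
  Hemisphere.alternating (s ∘ embed true) ε n (hemiUp (full ∘ embed true)) (false , origin)
    -- Above the equator the covers cancel by `up-full`. For a point of the equator only the cover
    -- above it counts, and that cover is full exactly when the point is full within the equator.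
    ≡⟨ alternating-equator (s ∘ embed true) ε n (hemiUp (full ∘ embed true)) origin up-full ⟩
  Sphere.alternating (s ∘ (nothing ∷_)) ε n (λ Y → up (λ _ → false) Y xor full Y) origin
    ≡⟨ Sphere.alternating-cong (s ∘ (nothing ∷_)) ε n (λ Y → cong (_xor full Y) (up-zero Y)) origin ⟩
  Sphere.alternating (s ∘ (nothing ∷_)) ε n full origin
    ≡⟨ alternating-full n (s ∘ (nothing ∷_)) (λ X p → odd (nothing ∷ X) (there p)) ε ⟩
  true ∎
  where
  open ≡-Reasoning
  H⁺ = λ ε → Hemisphere.alternating (s ∘ embed true) ε (suc n) (full ∘ embed true)

-- Ladders of values along an alternating chain

infix 4 _⊑_

data _⊑_ : ∀ {n} → SignVec n → SignVec n → Set where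
  []   : [] ⊑ []
  skip : ∀ {n y} {X Y : SignVec n} → X ⊑ Y → nothing ∷ X ⊑ y ∷ Y
  keep : ∀ {n ε} {X Y : SignVec n} → X ⊑ Y → just ε ∷ X ⊑ just ε ∷ Y

⊑-refl : ∀ {n} {X : SignVec n} → X ⊑ X
⊑-refl {X = []}          = []
⊑-refl {X = nothing ∷ X} = skip ⊑-refl
⊑-refl {X = just ε ∷ X}  = keep ⊑-refl

xor-true : ∀ a {b} → a xor b ≡ true → a ≡ true ⊎ b ≡ true
xor-true true  _  = inj₁ refl
xor-true false eq = inj₂ eq

up-witness : ∀ {n} (f : SignVec n → Bool) X → up f X ≡ true →
             ∃[ Y ] X ⊑ Y × Nonzero Y × f Y ≡ true
up-witness f (just ε ∷ X) eq with up-witness _ X eq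
... | Y , X⊑Y , _ , fY = _ , keep X⊑Y , here , fY
up-witness f (nothing ∷ X) eq with xor-true (up _ X) eq
... | inj₁ eq′ = let Y , X⊑Y , nz , fY = up-witness _ X eq′ in _ , skip X⊑Y , there nz , fY
... | inj₂ eq′ with xor-true (f (just true ∷ X)) eq′
...   | inj₁ fY = _ , skip ⊑-refl , here , fY
...   | inj₂ fY = _ , skip ⊑-refl , here , fY

-- With `Sides` for `R` this records an alternating chain: one rung for each vector, whose ends are
-- the values of the two signs there.
data Ladder (R : ℕ → ℕ → Set) (l : ℕ) : ℕ → Set where
  []   : Ladder R l 0
  rung : ∀ {u v r} → l ≤ u → u < v → R u v → Ladder R v r → Ladder R l (suc r)

drop-rungs : ∀ {R l} j {r} → Ladder R l (j + r) → ∃[ l′ ] j + l ≤ l′ × Ladder R l′ r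
drop-rungs zero    L = _ , ≤-refl , L
drop-rungs {l = l} (suc j) (rung {v = v} l≤u u<v _ L) with drop-rungs j L
... | l′ , le , L′ = l′ , ≤-trans (≤-trans (≤-reflexive (sym (+-suc j l)))
                            (+-monoʳ-≤ j (≤-<-trans l≤u u<v))) le , L′

-- Two values for each vector, one per sign. Comparing them gives the odd function to which Fan's
-- lemma is applied.
record Potential {n : ℕ} (M : Bool → SignVec n → ℕ) : Set where
  field
    monotone  : ∀ ε {X Y} → X ⊑ Y → M ε X ≤ M ε Y
    antipodal : ∀ ε X → M ε (neg X) ≡ M (not ε) X
    separated : ∀ ε {X} → Nonzero X → M ε X ≢ M (not ε) X

module _ {n : ℕ} {M : Bool → SignVec n → ℕ} (potential : Potential M) where
  open Potential potential

  Sides : ℕ → ℕ → Set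
  Sides u v = ∃[ Y ] ∃[ ε ] u ≡ M ε Y × v ≡ M (not ε) Y

  dominant : SignVec n → Bool
  dominant X = M false X <ᵇ M true X

  <ᵇ-asym : ∀ m n → m ≢ n → (n <ᵇ m) ≡ not (m <ᵇ n)
  <ᵇ-asym zero    zero    m≢n = contradiction refl m≢n
  <ᵇ-asym zero    (suc n) m≢n = refl
  <ᵇ-asym (suc m) zero    m≢n = refl
  <ᵇ-asym (suc m) (suc n) m≢n = <ᵇ-asym m n (m≢n ∘ cong suc)

  dominant-odd : ∀ X → Nonzero X → dominant (neg X) ≡ not (dominant X)
  dominant-odd X nz rewrite antipodal false X | antipodal true X =
    <ᵇ-asym (M false X) (M true X) (separated false nz)

  dominant-< : ∀ ε {Y} → Nonzero Y → dominant Y xor ε ≡ true → M ε Y < M (not ε) Y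
  dominant-< ε {Y} nz eq with M false Y <ᵇ M true Y in s
  dominant-< false {Y} nz eq | true  = <ᵇ⇒< _ _ (subst IsTrue (sym s) _)
  dominant-< true  {Y} nz eq | false = ≤∧≢⇒<
    (≮⇒≥ (λ lt → subst IsTrue s (<⇒<ᵇ lt))) (separated true nz)

  -- The dominant sign alternates along the chain, so the sign with the larger value at one vector
  -- has the smaller value at the next. Monotonicity for that sign joins consecutive rungs.
  ladder : ∀ ε r f X → Sphere.alternating dominant ε r f X ≡ true → Ladder Sides (M ε X) r
  ladder ε zero    f X eq = []
  ladder ε (suc r) f X eq with up-witness _ X eq
  ... | Y , X⊑Y , nz , both with dominant Y xor ε in d
  ... | true = rung (monotone ε X⊑Y) (dominant-< ε nz d) (Y , ε , refl , refl)
                 (ladder (not ε) r f Y both)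

  full-ladder : Ladder Sides (M false origin) n
  full-ladder = ladder false n full origin (alternating-full n dominant dominant-odd false)

-- Schrijver's theorem

-- The length of a longest alternating subsequence of signs that starts with `ε`, computed greedily.
alt : ∀ {n} → Bool → SignVec n → ℕ
alt ε []            = 0
alt ε (nothing ∷ X) = alt ε X
alt ε (just δ ∷ X)  = ifᵇ δ xor ε then alt ε X else suc (alt (not ε) X)

height : ∀ {n} → SignVec n → ℕ
height X = alt false X ⊔ alt true X

alt-flip : ∀ {n} ε (X : SignVec n) → alt ε X ≤ suc (alt (not ε) X)
alt-flip ε     []               = z≤n
alt-flip ε     (nothing ∷ X)    = alt-flip ε X
alt-flip false (just false ∷ X) = ≤-refl
alt-flip true  (just true ∷ X)  = ≤-refl
alt-flip false (just true ∷ X)  = m≤n⇒m≤1+n (n≤1+n _)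
alt-flip true  (just false ∷ X) = m≤n⇒m≤1+n (n≤1+n _)

alt-cons : ∀ {n} ε x (X : SignVec n) → alt (not ε) (x ∷ X) ≤ suc (alt ε X)
alt-cons false nothing      X = alt-flip true X
alt-cons true  nothing      X = alt-flip false X
alt-cons false (just false) X = alt-flip true X
alt-cons true  (just true)  X = alt-flip false X
alt-cons false (just true)  X = ≤-refl
alt-cons true  (just false) X = ≤-refl

alt-≤ : ∀ {n} ε (X : SignVec n) → alt ε X ≤ n
alt-≤ ε     []      = z≤n
alt-≤ false (x ∷ X) = ≤-trans (alt-cons true x X) (s≤s (alt-≤ true X))
alt-≤ true  (x ∷ X) = ≤-trans (alt-cons false x X) (s≤s (alt-≤ false X))

alt-mono : ∀ {n} ε {X Y : SignVec n} → X ⊑ Y → alt ε X ≤ alt ε Y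
alt-mono ε []                        = z≤n
alt-mono ε (skip {y = nothing} p)    = alt-mono ε p
alt-mono ε (skip {y = just δ} {Y = Y} p) with δ xor ε
... | true  = alt-mono ε p
... | false = ≤-trans (alt-mono ε p) (alt-flip ε Y)
alt-mono ε (keep {ε = δ} p) with δ xor ε
... | true  = alt-mono ε p
... | false = s≤s (alt-mono (not ε) p)

alt-neg : ∀ {n} ε (X : SignVec n) → alt ε (neg X) ≡ alt (not ε) X
alt-neg ε     []               = refl
alt-neg ε     (nothing ∷ X)    = alt-neg ε X
alt-neg false (just false ∷ X) = alt-neg false X
alt-neg true  (just true ∷ X)  = alt-neg true X
alt-neg false (just true ∷ X)  = cong suc (alt-neg true X)
alt-neg true  (just false ∷ X) = cong suc (alt-neg false X)

alt-separated-just : ∀ {n} ε δ (X : SignVec n) → alt ε (just δ ∷ X) ≢ alt (not ε) (just δ ∷ X)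
alt-separated-just false false X = 1+n≢n
alt-separated-just true  true  X = 1+n≢n
alt-separated-just false true  X = 1+n≢n ∘ sym
alt-separated-just true  false X = 1+n≢n ∘ sym

-- A longest sequence starting with the first nonzero sign is one longer than a longest sequence
-- starting with the opposite sign.
alt-separated : ∀ {n} ε {X : SignVec n} → Nonzero X → alt ε X ≢ alt (not ε) X
alt-separated ε {just δ ∷ X}  _         = alt-separated-just ε δ X
alt-separated ε {nothing ∷ X} (there p) = alt-separated ε p

height-mono : ∀ {n} {X Y : SignVec n} → X ⊑ Y → height X ≤ height Y
height-mono p = ⊔-mono-≤ (alt-mono false p) (alt-mono true p)

height-neg : ∀ {n} (X : SignVec n) → height (neg X) ≡ height X
height-neg X = trans (cong₂ _⊔_ (alt-neg false X) (alt-neg true X)) (⊔-comm (alt true X) (alt false X))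

height≤ : ∀ {n b} ε (X : SignVec n) → alt ε X ≤ b → alt (not ε) X ≤ b → height X ≤ b
height≤ false X p q = ⊔-lub p q
height≤ true  X p q = ⊔-lub q p

alt≤height : ∀ {n} ε (X : SignVec n) → alt ε X ≤ height X
alt≤height false X = m≤m⊔n _ _
alt≤height true  X = m≤n⊔m _ _

data _⊆[_]_ : ∀ {n} → Vec Bool n → Bool → SignVec n → Set where
  []  : ∀ {ε} → [] ⊆[ ε ] []
  out : ∀ {n ε x w} {X : SignVec n} → w ⊆[ ε ] X → (false ∷ w) ⊆[ ε ] (x ∷ X)
  inn : ∀ {n ε w} {X : SignVec n} → w ⊆[ ε ] X → (true ∷ w) ⊆[ ε ] (just ε ∷ X)

⊆-⊑ : ∀ {n ε w} {X Y : SignVec n} → w ⊆[ ε ] X → X ⊑ Y → w ⊆[ ε ] Y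
⊆-⊑ []      []       = []
⊆-⊑ (out p) (skip q) = out (⊆-⊑ p q)
⊆-⊑ (out p) (keep q) = out (⊆-⊑ p q)
⊆-⊑ (inn p) (keep q) = inn (⊆-⊑ p q)

Disjoint : List Bool → List Bool → Set
Disjoint = Pointwise λ a b → a ∧ b ≡ false

⊆-disjoint : ∀ {n ε ε′} {w w′} {X : SignVec n} → ε ≢ ε′ →
             w ⊆[ ε ] X → w′ ⊆[ ε′ ] X → Disjoint (toList w) (toList w′)
⊆-disjoint ne []      []      = []
⊆-disjoint ne (out p) (out q) = refl ∷ ⊆-disjoint ne p q
⊆-disjoint ne (out p) (inn q) = refl ∷ ⊆-disjoint ne p q
⊆-disjoint ne (inn p) (out q) = refl ∷ ⊆-disjoint ne p q
⊆-disjoint ne (inn p) (inn q) = contradiction refl ne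

-- The maximum of `g` over the words whose letters `true` sit at entries `ε` of the vector.
largest : ∀ {n} → Bool → (Vec Bool n → ℕ) → SignVec n → ℕ
largest ε g []            = g []
largest ε g (nothing ∷ X) = largest ε (g ∘ (false ∷_)) X
largest ε g (just δ ∷ X)  =
  ifᵇ δ xor ε then largest ε (g ∘ (false ∷_)) X
             else largest ε (g ∘ (true ∷_)) X ⊔ largest ε (g ∘ (false ∷_)) X

largest-upper : ∀ {n} ε g {w} {X : SignVec n} → w ⊆[ ε ] X → g w ≤ largest ε g X
largest-upper ε g []                   = ≤-refl
largest-upper ε g (out {x = nothing} p) = largest-upper ε _ p
largest-upper ε g (out {x = just δ} {X = X} p) with δ xor ε
... | true  = largest-upper ε _ p
... | false = m≤n⇒m≤o⊔n (largest ε (g ∘ (true ∷_)) X) (largest-upper ε _ p)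
largest-upper ε g (inn p) rewrite xor-same ε = m≤n⇒m≤n⊔o _ (largest-upper ε _ p)

xor-false⇒≡ : ∀ a b → a xor b ≡ false → a ≡ b
xor-false⇒≡ false b eq = sym eq
xor-false⇒≡ true true eq = refl

largest-attained : ∀ {n} ε g (X : SignVec n) → ∃[ w ] w ⊆[ ε ] X × g w ≡ largest ε g X
largest-attained ε g [] = [] , [] , refl
largest-attained ε g (nothing ∷ X) with largest-attained ε (g ∘ (false ∷_)) X
... | w , p , eq = false ∷ w , out p , eq
largest-attained ε g (just δ ∷ X) with δ xor ε in δε | largest-attained ε (g ∘ (false ∷_)) X
... | true  | w , p , eq = false ∷ w , out p , eq
... | false | w , p , eq with ⊔-sel (largest ε (g ∘ (true ∷_)) X) (largest ε (g ∘ (false ∷_)) X)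
...   | inj₂ sel = false ∷ w , out p , trans eq (sym sel)
...   | inj₁ sel with xor-false⇒≡ δ ε δε | largest-attained ε (g ∘ (true ∷_)) X
...     | refl | w′ , p′ , eq′ = true ∷ w′ , inn p′ , trans eq′ (sym sel)

largest-mono : ∀ {n} ε g {X Y : SignVec n} → X ⊑ Y → largest ε g X ≤ largest ε g Y
largest-mono ε g {X} p with largest-attained ε g X
... | w , w⊆X , eq = ≤-trans (≤-reflexive (sym eq)) (largest-upper ε g (⊆-⊑ w⊆X p))

largest-neg : ∀ {n} ε g (X : SignVec n) → largest ε g (neg X) ≡ largest (not ε) g X
largest-neg ε     g []               = refl
largest-neg ε     g (nothing ∷ X)    = largest-neg ε _ X
largest-neg false g (just false ∷ X) = largest-neg false _ X
largest-neg true  g (just true ∷ X)  = largest-neg true _ X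
largest-neg false g (just true ∷ X)  = cong₂ _⊔_ (largest-neg false _ X) (largest-neg false _ X)
largest-neg true  g (just false ∷ X) = cong₂ _⊔_ (largest-neg true _ X) (largest-neg true _ X)

-- Words with κ letters t (not t) and ζ letters false.  Every cyclically stable
-- set avoiding the last element is such a word for t = true, and every one
-- avoiding the first element for t = false.
data Tok (t : Bool) : ℕ → ℕ → List Bool → Set where
  []  : Tok t 0 0 []
  one : ∀ {κ ζ w} → Tok t κ ζ w → Tok t (suc κ) ζ (t ∷ not t ∷ w)
  zer : ∀ {κ ζ w} → Tok t κ ζ w → Tok t κ (suc ζ) (false ∷ w)

k≤0 : ∀ {k} → k * 2 ≤ 0 → k ≡ 0
k≤0 {zero} _ = refl

mutual
  -- Greedy choice from the left: an entry `ε` is taken together with the letter after it, which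
  -- lowers the number of alternations by at most two. A letter passed over becomes a zero. The `b`
  -- zeros suffice, because the letters behind a zero still carry 2`k` alternations and so number at
  -- least 2`k`.
  selectˡ : ∀ {n} ε k b (X : SignVec n) → n ≡ k * 2 + b → k * 2 ≤ alt ε X →
            ∃[ w ] w ⊆[ ε ] X × Tok true k b (toList w)
  selectˡ ε zero zero [] eq le = [] , [] , []
  selectˡ ε zero b (x ∷ X) refl le = selectˡ-zer ε zero b x X refl z≤n
  selectˡ ε k b (nothing ∷ X) eq le = selectˡ-zer ε k b nothing X eq le
  selectˡ ε (suc k) b (just δ ∷ X) eq le with δ xor ε in δε
  ... | true = selectˡ-zer ε (suc k) b (just δ) X eq le
  selectˡ ε (suc k) b (just δ ∷ y ∷ X) refl (s≤s le) | false
    with refl ← xor-false⇒≡ δ ε δε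
    with selectˡ ε k b X refl (s≤s⁻¹ (≤-trans le (alt-cons ε y X)))
  ... | w , p , tok = true ∷ false ∷ w , inn (out p) , one tok

  selectˡ-zer : ∀ {n} ε k b x (X : SignVec n) → suc n ≡ k * 2 + b → k * 2 ≤ alt ε X →
                ∃[ w ] w ⊆[ ε ] (x ∷ X) × Tok true k b (toList w)
  selectˡ-zer {n} ε k zero x X eq le = contradiction (alt-≤ ε X)
    (<⇒≱ (≤-trans (≤-reflexive (trans eq (+-identityʳ _))) le))
  selectˡ-zer ε k (suc b) x X eq le
    with w , p , tok ← selectˡ ε k b X (suc-injective (trans eq (+-suc _ b))) le =
    false ∷ w , out p , zer tok

mutual
  -- The word is completed by a letter false in front, which the caller provides.
  selectʳ : ∀ {n} ε k b (X : SignVec n) → suc n ≡ k * 2 + b → k * 2 ≤ suc (alt ε X) →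
            ∃[ w ] w ⊆[ ε ] X × Tok false k b (false ∷ toList w)
  selectʳ ε zero (suc zero) [] eq le = [] , [] , zer []
  selectʳ ε zero b (x ∷ X) eq le = selectʳ-zer ε zero b x X eq z≤n
  selectʳ ε k b (nothing ∷ X) eq le = selectʳ-zer ε k b nothing X eq le
  selectʳ ε (suc k) b (just δ ∷ X) eq le with δ xor ε in δε
  ... | true = selectʳ-zer ε (suc k) b (just δ) X eq le
  -- The last letter can complete a token, since the `false` of that token lies in front of it. This
  -- is why one alternation fewer is enough.
  selectʳ ε (suc k) b (just δ ∷ []) eq (s≤s (s≤s le)) | false
    with refl ← xor-false⇒≡ δ ε δε | refl ← k≤0 {k} le | b | eq
  ... | zero | refl = true ∷ [] , inn [] , one []
  selectʳ ε (suc k) b (just δ ∷ x ∷ X) eq (s≤s (s≤s le)) | false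
    with refl ← xor-false⇒≡ δ ε δε
    with selectʳ ε k b X (suc-injective (suc-injective eq)) (≤-trans le (alt-cons ε x X))
  ... | w , p , tok = true ∷ false ∷ w , inn (out p) , one tok

  selectʳ-zer : ∀ {n} ε k b x (X : SignVec n) → suc (suc n) ≡ k * 2 + b → k * 2 ≤ suc (alt ε X) →
                ∃[ w ] w ⊆[ ε ] (x ∷ X) × Tok false k b (false ∷ toList w)
  selectʳ-zer ε k zero x X eq le = contradiction (s≤s (alt-≤ ε X))
    (<⇒≱ (≤-trans (≤-reflexive (trans eq (+-identityʳ _))) le))
  selectʳ-zer ε k (suc b) x X eq le
    with w , p , tok ← selectʳ ε k b X (suc-injective (trans eq (+-suc _ b))) le =
    false ∷ w , out p , zer tok

-- If a longest alternating sequence starts with `ε`, each chosen entry is paired with the letter to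
-- its right. Otherwise it starts with the opposite sign; then the first letter is left out and each
-- chosen entry is paired with the letter to its left.
select : ∀ ε k b (X : SignVec (suc k * 2 + b)) → suc k * 2 ≤ height X →
         ∃[ t ] ∃[ w ] w ⊆[ ε ] X × Tok t (suc k) b (toList w)
select ε k b X le with ≤-total (alt (not ε) X) (alt ε X)
... | inj₁ ge = true , selectˡ ε (suc k) b X refl (≤-trans le (height≤ ε X ≤-refl ge))
select ε k b (x ∷ X) le | inj₂ ge
  with w , p , tok ← selectʳ ε (suc k) b X refl
         (≤-trans le (≤-trans (height≤ ε (x ∷ X) ge ≤-refl) (alt-cons ε x X))) =
  false , false ∷ w , out p , tok

-- Distinct values on the stable sets of a single block

data Climb (P : ℕ → Set) (l : ℕ) : ℕ → Set where
  []   : Climb P l 0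
  step : ∀ {v r} → l < v → P v → Climb P v r → Climb P l (suc r)

module _ {P : ℕ → Set} where
  at : ∀ {l r} → Climb P l r → Fin r → ℕ
  at (step {v} _ _ _) zero    = v
  at (step _ _ c)     (suc i) = at c i

  at-P : ∀ {l r} (c : Climb P l r) i → P (at c i)
  at-P (step _ p _) zero    = p
  at-P (step _ _ c) (suc i) = at-P c i

  at-> : ∀ {l r} (c : Climb P l r) i → l < at c i
  at-> (step l<v _ _) zero    = l<v
  at-> (step l<v _ c) (suc i) = <-trans l<v (at-> c i)

  at-injective : ∀ {l r} (c : Climb P l r) i j → at c i ≡ at c j → i ≡ j
  at-injective (step _ _ c) zero    zero    eq = refl
  at-injective (step _ _ c) zero    (suc j) eq = contradiction eq (<⇒≢ (at-> c j))
  at-injective (step _ _ c) (suc i) zero    eq = contradiction (sym eq) (<⇒≢ (at-> c i))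
  at-injective (step _ _ c) (suc i) (suc j) eq = cong suc (at-injective c i j eq)

module _ (k b : ℕ) (g : Vec Bool (suc k * 2 + b) → ℕ)
  (covers : ∀ t w → Tok t (suc k) b (toList w) → 0 < g w)
  (proper : ∀ w w′ → 0 < g w → 0 < g w′ → Disjoint (toList w) (toList w′) → g w ≢ g w′)
  where

  private
    K = suc k * 2

  -- The summand `K` keeps the potential monotone across the threshold, since below it no count of
  -- alternations reaches `K`.
  potential : Bool → SignVec (K + b) → ℕ
  potential ε X with K ≤? height X
  ... | yes _ = K + largest ε g X
  ... | no  _ = alt ε X

  largest-positive : ∀ ε X → K ≤ height X → 0 < largest ε g X
  largest-positive ε X high with select ε k b X high
  ... | t , w , p , tok = ≤-trans (covers t w tok) (largest-upper ε g p)

  potential-isPotential : Potential potential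
  potential-isPotential = record
    { monotone = monotone ; antipodal = antipodal ; separated = separated }
    where
    monotone : ∀ ε {X Y} → X ⊑ Y → potential ε X ≤ potential ε Y
    monotone ε {X} {Y} p with K ≤? height X | K ≤? height Y
    ... | yes _    | yes _   = +-monoʳ-≤ K (largest-mono ε g p)
    ... | yes high | no ¬high = contradiction (≤-trans high (height-mono p)) ¬high
    ... | no ¬high | yes _   = ≤-trans (alt≤height ε X) (≤-trans (<⇒≤ (≰⇒> ¬high)) (m≤m+n K _))
    ... | no _     | no _    = alt-mono ε p

    antipodal : ∀ ε X → potential ε (neg X) ≡ potential (not ε) X
    antipodal ε X with K ≤? height (neg X) | K ≤? height X
    ... | yes _ | yes _ = cong (K +_) (largest-neg ε g X)
    ... | no _  | no _  = alt-neg ε X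
    ... | yes p | no ¬p = contradiction (subst (K ≤_) (height-neg X) p) ¬p
    ... | no ¬p | yes p = contradiction (subst (K ≤_) (sym (height-neg X)) p) ¬p

    separated : ∀ ε {X} → Nonzero X → potential ε X ≢ potential (not ε) X
    separated ε {X} nz eq with K ≤? height X
    ... | no _ = alt-separated ε nz eq
    ... | yes high with largest-attained ε g X | largest-attained (not ε) g X
    -- The maximising words of the two signs are disjoint, so equal maxima would contradict
    -- `proper`.
    ...   | w , p , eqw | w′ , p′ , eqw′ = proper w w′
      (subst (0 <_) (sym eqw) (largest-positive ε X high))
      (subst (0 <_) (sym eqw′) (largest-positive (not ε) X high))
      (⊆-disjoint (not-¬ refl) p p′)
      (trans eqw (trans (+-cancelˡ-≡ K _ _ eq) (sym eqw′)))

  Attained : ℕ → Set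
  Attained v = ∃[ w ] g w ≡ v

  -- Below the threshold both sides are counts of alternations, which the height bounds.
  high-sides : ∀ {u v} → Sides potential-isPotential u v → K ≤ v →
               ∃[ u′ ] ∃[ v′ ] u ≡ K + u′ × v ≡ K + v′ × 0 < u′ × Attained u′ × Attained v′
  high-sides (Y , ε , refl , refl) K≤v with K ≤? height Y
  ... | no ¬high = contradiction (≤-trans K≤v (alt≤height (not ε) Y)) ¬high
  ... | yes high with largest-attained ε g Y | largest-attained (not ε) g Y
  ...   | w , _ , eqw | w′ , _ , eqw′ =
    _ , _ , refl , refl , largest-positive ε Y high , (w , eqw) , (w′ , eqw′)

  climb : ∀ {r} l v → l ≡ K + v → Ladder (Sides potential-isPotential) l r → Climb Attained v r
  climb l v l≡ [] = []
  climb l v l≡ (rung {v = v₁} le lt sides L)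
    with high-sides sides (≤-trans (m≤m+n K v) (≤-trans (≤-reflexive (sym l≡)) (≤-trans le (<⇒≤ lt))))
  ... | _ , v′ , _ , v₁≡ , _ , _ , at =
    step (+-cancelˡ-< K _ _ (subst₂ _<_ l≡ v₁≡ (≤-<-trans le lt))) at (climb v₁ v′ v₁≡ L)

  -- The step to height K contributes two values, one for each sign.
  climb-from-threshold : ∀ {l r} → suc (k * 2) ≤ l → Ladder (Sides potential-isPotential) l (suc r) →
                         Climb Attained 0 (2 + r)
  climb-from-threshold le (rung {v = v} l≤u u<v sides L)
    with high-sides sides (≤-trans (s≤s (≤-trans le l≤u)) u<v)
  ... | u′ , v′ , u≡ , v≡ , 0<u′ , atu , atv =
    step 0<u′ atu (step (+-cancelˡ-< K _ _ (subst₂ _<_ u≡ v≡ u<v)) atv (climb v v′ v≡ L))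

  -- Of the `K` + `b` rungs the first `K` - 1 are dropped, after which every upper end is at least
  -- `K`. The remaining `b` + 1 rungs give `b` + 2 values, two of them from the first rung.
  colourful : Climb Attained 0 (2 + b)
  colourful =
    let _ , le , L = dropped in climb-from-threshold (≤-trans (m≤m+n (suc (k * 2)) _) le) L
    where
    dropped : ∃[ l ] suc (k * 2) + potential false origin ≤ l × Ladder (Sides potential-isPotential) l (suc b)
    dropped = drop-rungs (suc (k * 2)) (subst (Ladder (Sides potential-isPotential) (potential false origin))
      (cong suc (sym (+-suc (k * 2) b))) (full-ladder potential-isPotential))

-- Oracle programs with time bounds

-- A Hoare triple for total correctness, with `T` an upper bound on the steps.
Halts : ∀ {v} → Oracle → Cmd v → ℕ → Store v → (Store v → Set) → Set
Halts O p T σ Q = ∃[ τ ] ∃[ t ] (O ⊢ p , σ ⇓ τ [ t ]) × t ≤ T × Q τ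

module _ {v : ℕ} {O : Oracle} where

  halts-≤ : ∀ {p : Cmd v} {S T σ Q} → S ≤ T → Halts O p S σ Q → Halts O p T σ Q
  halts-≤ S≤T (τ , t , run , t≤S , q) = τ , t , run , ≤-trans t≤S S≤T , q

  seqʰ : ∀ {p q : Cmd v} {S T σ Q R} →
         Halts O p S σ Q → (∀ τ → Q τ → Halts O q T τ R) → Halts O (p ⨾ q) (S + T) σ R
  seqʰ (τ , s , run , s≤S , Qτ) next with next τ Qτ
  ... | υ , t , run′ , t≤T , Rυ = υ , s + t , seq run run′ , +-mono-≤ s≤S t≤T , Rυ

  whileʰ : ∀ {e} {p : Cmd v} {S T σ Q R} → eval e σ ≢ nil →
           Halts O p S σ Q → (∀ τ → Q τ → Halts O (while e loop p) T τ R) →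
           Halts O (while e loop p) (1 + cost e + S + T) σ R
  whileʰ {e} ne (τ , s , run , s≤S , Qτ) next with next τ Qτ
  ... | υ , t , run′ , t≤T , Rυ =
    υ , _ , while-true ne run run′ , +-mono-≤ (+-monoʳ-≤ (1 + cost e) s≤S) t≤T , Rυ

  -- For straight-line code the step count is a numeral, so the hidden comparison is settled by
  -- evaluation.
  exactly : ∀ {p : Cmd v} {σ τ t} T {_ : IsTrue (t ≤ᵇ T)} → O ⊢ p , σ ⇓ τ [ t ] → Halts O p T σ (_≡ τ)
  exactly T {le} run = _ , _ , run , ≤ᵇ⇒≤ _ _ le , refl

  iterate : ∀ {e} {p : Cmd v} {σ τ s T R} S {_ : IsTrue (s ≤ᵇ S)} → eval e σ ≢ nil → O ⊢ p , σ ⇓ τ [ s ] →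
            Halts O (while e loop p) T τ R → Halts O (while e loop p) (1 + cost e + S + T) σ R
  iterate S {le} ne run rest = whileʰ ne (exactly S {le} run) λ { _ refl → rest }

-- The brute force search

Reg : Set
Reg = Fin 10

-- `io` holds the input and finally the answer, `work` the stack of the enumeration and later the
-- outer list of the comparison, `seen` the queried vertices with their colours.
io work seen r₁ r₂ r₃ r₄ r₅ r₆ r₇ : Reg
io = # 0
work = # 1
seen = # 2
r₁ = # 3
r₂ = # 4
r₃ = # 5
r₄ = # 6
r₅ = # 7
r₆ = # 8
r₇ = # 9

store : (io work seen p q r s t u v : Tree) → Store 10
store io work seen p q r s t u v = io ∷ work ∷ seen ∷ p ∷ q ∷ r ∷ s ∷ t ∷ u ∷ v ∷ []

one! : Tree
one! = nil ∙ nil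

-- There is no empty command, so a register is assigned to itself.
noop : Cmd 10
noop = r₆ := var r₆

dec : Reg → Cmd 10
dec x = x := tl (var x)

node : (w κ β a ts : Expr 10) → Expr 10
node w κ β a ts = cons w (cons κ (cons β (cons a ts)))

push : Expr 10 → Cmd 10
push e = work := cons e (var work)

stripKeys stripSlack : Cmd 10
stripKeys  = while var r₂ loop (r₁ := tl (tl (var r₁)) ⨾ dec r₂)
stripSlack = while var r₂ loop (dec r₁ ⨾ dec r₂)

-- A zero bit and a unary successor have the same encoding, so the counter r₁ is
-- also the block of zeros with which a word ends.  It starts one too high, since
-- the empty block is wanted as well.
plant : ℕ → Cmd 10
plant b = while var r₁ loop
  ( push (node (tl (var r₁)) (tl (var io)) (quot ⌜ b ⌝ℕ) (var r₄) (quot (nil ∙ one!)))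
  ⨾ push (node (tl (var r₁)) (tl (var io)) (quot ⌜ b ⌝ℕ) (var r₄) (quot (one! ∙ nil)))
  ⨾ r₄ := cons (quot nil) (var r₄)
  ⨾ dec r₁)

-- Depth-first search; see Partial for the entries of the stack.
expand : Cmd 10
expand = while var work loop
  ( r₁ := hd (hd (var work))
  ⨾ r₂ := hd (tl (hd (var work)))
  ⨾ r₃ := hd (tl (tl (hd (var work))))
  ⨾ r₄ := hd (tl (tl (tl (hd (var work)))))
  ⨾ r₅ := tl (tl (tl (tl (hd (var work)))))
  ⨾ dec work
  ⨾ if var r₂
    then push (node (cons (hd (var r₅)) (cons (tl (var r₅)) (var r₁))) (tl (var r₂)) (var r₃) (var r₄) (var r₅))
    else noop
  ⨾ if var r₃
    then push (node (cons (quot nil) (var r₁)) (var r₂) (tl (var r₃)) (var r₄) (var r₅))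
    else if var r₂ then noop
    else if var r₄
    then push (node (cons (quot nil) (var r₁)) (var r₂) (var r₃) (tl (var r₄)) (var r₅))
    else (r₆ :=query var r₁ ⨾ seen := cons (cons (var r₁) (var r₆)) (var seen)))

-- The flag `r₅` is cleared by a common element, and by a first colour that exceeds the second. A
-- second colour that exceeds the first leaves a remainder in `r₄`, which `report` rejects.
compareSets compareColours report compare scan search : Cmd 10
compareSets = while var r₁ loop
  ( if hd (var r₁) then (if hd (var r₂) then r₅ := quot nil else noop) else noop
  ⨾ dec r₁
  ⨾ dec r₂)
compareColours = while var r₃ loop
  ( if var r₄ then noop else (r₅ := quot nil)
  ⨾ dec r₃
  ⨾ dec r₄)
report = if var r₄ then noop
  else if var r₅ then (io := cons (hd (hd (var work))) (hd (hd (var r₇)))) else noop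
compare =
    r₁ := hd (hd (var work))
  ⨾ r₂ := hd (hd (var r₇))
  ⨾ r₃ := tl (hd (var work))
  ⨾ r₄ := tl (hd (var r₇))
  ⨾ r₅ := quot one!
  ⨾ compareSets
  ⨾ compareColours
  ⨾ report
scan = while var r₇ loop (compare ⨾ dec r₇)
search = while var work loop (r₇ := var seen ⨾ scan ⨾ dec work)

bruteForce : ℕ → Cmd 10
bruteForce b =
    -- From `n` + 1 the first two loops subtract 2`k` and `b`. What is left is the number of
    -- positions of a window of length 2`k` + `b`.
    r₁ := cons (quot nil) (hd (var io))
  ⨾ r₂ := tl (var io)
  ⨾ stripKeys
  ⨾ r₂ := quot ⌜ b ⌝ℕ
  ⨾ stripSlack
  ⨾ plant b
  ⨾ expand
  ⨾ work := var seen
  ⨾ search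

⌜_⌝word : List Bool → Tree
⌜ [] ⌝word    = nil
⌜ x ∷ w ⌝word = ⌜ x ⌝Bool ∙ ⌜ w ⌝word

⌜⌝Subset-toList : ∀ {n} (A : Vec Bool n) → ⌜ A ⌝Subset ≡ ⌜ toList A ⌝word
⌜⌝Subset-toList []      = refl
⌜⌝Subset-toList (x ∷ A) = cong (⌜ x ⌝Bool ∙_) (⌜⌝Subset-toList A)

stripKeys-halts : ∀ {O} k l {z w s t u v} →
  Halts O stripKeys (k * 20 + 2) (store z nil w ⌜ k * 2 + l ⌝ℕ ⌜ k ⌝ℕ nil s t u v)
    (_≡ store z nil w ⌜ l ⌝ℕ nil nil s t u v)
stripKeys-halts zero    l = exactly 2 (while-false refl)
stripKeys-halts (suc k) l =
  iterate 18 (λ ()) (seq assign assign) (stripKeys-halts k l)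

stripSlack-halts : ∀ {O} b l {z w s t u v} →
  Halts O stripSlack (b * 20 + 2) (store z nil w ⌜ b + l ⌝ℕ ⌜ b ⌝ℕ nil s t u v)
    (_≡ store z nil w ⌜ l ⌝ℕ nil nil s t u v)
stripSlack-halts zero    l = exactly 2 (while-false refl)
stripSlack-halts (suc b) l =
  iterate 18 (λ ()) (seq assign assign) (stripSlack-halts b l)

-- Enumeration of stable sets as words of tokens

∉-first : ∀ {κ ζ w} → Tok false κ ζ w → ∀ i → toℕ i ≡ 0 → i ∉ fromList w
∉-first (one _) zero _ ()
∉-first (zer _) zero _ ()

∉-last : ∀ {κ ζ w} → Tok true κ ζ w → ∀ j → suc (toℕ j) ≡ length w → j ∉ fromList w
∉-last (one tok) (suc (suc j)) eq (Vec.there (Vec.there p)) = ∉-last tok j (suc-injective (suc-injective eq)) p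
∉-last (zer tok) (suc j)       eq (Vec.there p)             = ∉-last tok j (suc-injective eq) p

∈-noConsecutive : ∀ {κ ζ w} t → Tok t κ ζ w →
                  ∀ i j → i ∈ fromList w → j ∈ fromList w → toℕ j ≢ suc (toℕ i)
∈-noConsecutive t     (zer tok) (suc i) (suc j) (Vec.there p) (Vec.there p′) eq =
  ∈-noConsecutive t tok i j p p′ (suc-injective eq)
∈-noConsecutive true  (one tok) zero (suc zero) Vec.here (Vec.there ()) eq
∈-noConsecutive true  (one tok) (suc (suc i)) (suc (suc j)) (Vec.there (Vec.there p)) (Vec.there (Vec.there p′)) eq =
  ∈-noConsecutive true tok i j p p′ (suc-injective (suc-injective eq))
∈-noConsecutive false (one tok) (suc zero) (suc (suc j)) (Vec.there p) (Vec.there (Vec.there p′)) eq =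
  ∉-first tok j (suc-injective (suc-injective eq)) p′
∈-noConsecutive false (one tok) (suc (suc i)) (suc (suc j)) (Vec.there (Vec.there p)) (Vec.there (Vec.there p′)) eq =
  ∈-noConsecutive false tok i j p p′ (suc-injective (suc-injective eq))

-- Every letter `true` has its `false` on a fixed side, so no two are adjacent. At one end the word
-- has `false`, which excludes the pair of first and last.
stable-fromList : ∀ {t κ ζ w} → Tok t κ ζ w → Stable (fromList w)
stable-fromList {t} tok = record
  { noConsecutive   = ∈-noConsecutive t tok
  ; notFirstAndLast = firstOrLast t tok
  }
  where
  firstOrLast : ∀ {κ ζ w} t → Tok t κ ζ w → ∀ i j → toℕ i ≡ 0 → suc (toℕ j) ≡ length w →
                ¬ (i ∈ fromList w × j ∈ fromList w)
  firstOrLast true  tok i j _ l (_ , p) = ∉-last tok j l p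
  firstOrLast false tok i j f _ (p , _) = ∉-first tok i f p

size-fromList : ∀ {t κ ζ w} → Tok t κ ζ w → ∣ fromList w ∣ ≡ κ
size-fromList [] = refl
size-fromList {true}  (one tok) = cong suc (size-fromList tok)
size-fromList {false} (one tok) = cong suc (size-fromList tok)
size-fromList (zer tok) = size-fromList tok

toVertex : ∀ {t n k ζ w} → length w ≡ n → Tok t k ζ w → Vertex n k
toVertex {w = w} refl tok = vertex (fromList w) (stable-fromList tok) (size-fromList tok)

bits : ∀ {n k} → Vertex n k → List Bool
bits A = toList (set A)

bits-toVertex : ∀ {t n k ζ w} (eq : length w ≡ n) (tok : Tok t k ζ w) → bits (toVertex eq tok) ≡ w
bits-toVertex {w = w} refl tok = toList∘fromList w

-- The partial words of the search: word is to be extended to the left by κ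
-- more tokens, β zeros between them, and a zeros of padding.
record Partial (n k : ℕ) (t : Bool) (κ β a : ℕ) : Set where
  constructor partial
  field
    {κ′ ζ} : ℕ
    {word} : List Bool
    tok    : Tok t κ′ ζ word
    keys   : κ + κ′ ≡ k
    size   : κ * 2 + (β + (a + length word)) ≡ n

open Partial using (word)

module _ {n k : ℕ} {t : Bool} where

  addToken : ∀ {κ β a} → Partial n k t (suc κ) β a → Partial n k t κ β a
  addToken {κ} {β} {a} (partial {word = w} tok keys size) =
    partial (one tok) (trans (+-suc κ _) keys) (trans (shift κ β a (length w)) size)
    where
    shift : ∀ κ β a l → κ * 2 + (β + (a + (2 + l))) ≡ 2 + (κ * 2 + (β + (a + l)))
    shift = solve 4 (λ κ β a l → κ :* con 2 :+ (β :+ (a :+ (con 2 :+ l))) :≡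
                                 con 2 :+ (κ :* con 2 :+ (β :+ (a :+ l)))) refl

  addZero : ∀ {κ β a} → Partial n k t κ (suc β) a → Partial n k t κ β a
  addZero {κ} {β} {a} (partial {word = w} tok keys size) =
    partial (zer tok) keys (trans (cong (κ * 2 +_) (trans (cong (β +_) (+-suc a _)) (+-suc β _))) size)

  pad : ∀ {κ β a} → Partial n k t κ β (suc a) → Partial n k t κ β a
  pad {κ} {β} {a} (partial {word = w} tok keys size) =
    partial (zer tok) keys (trans (cong (λ l → κ * 2 + (β + l)) (+-suc a _)) size)

  done : Partial n k t 0 0 0 → Vertex n k
  done (partial tok refl size) = toVertex size tok

  bits-done : (P : Partial n k t 0 0 0) → bits (done P) ≡ word P
  bits-done (partial tok refl size) = bits-toVertex size tok

  -- The nesting follows the stack of `expand`: the branch with a zero is pushed last and hence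
  -- worked off first.
  completions : ∀ κ β a → Partial n k t κ β a → List (Vertex n k) → List (Vertex n k)
  completions zero    zero    zero    P acc = done P ∷ acc
  completions zero    zero    (suc a) P acc = completions zero zero a (pad P) acc
  completions zero    (suc β) a       P acc = completions zero β a (addZero P) acc
  completions (suc κ) zero    a       P acc = completions κ zero a (addToken P) acc
  completions (suc κ) (suc β) a       P acc =
    completions κ (suc β) a (addToken P) (completions (suc κ) β a (addZero P) acc)

-- The number of nodes in the search tree of such an entry, that is, of passes through the loop of
-- `expand`.
visits : (κ β a : ℕ) → ℕ
visits zero    zero    zero    = 1
visits zero    zero    (suc a) = 1 + visits zero zero a
visits zero    (suc β) a       = 1 + visits zero β a
visits (suc κ) zero    a       = 1 + visits κ zero a
visits (suc κ) (suc β) a       = 1 + (visits (suc κ) β a + visits κ (suc β) a)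

length-completions : ∀ {n k t} κ β a (P : Partial n k t κ β a) acc →
                     length (completions κ β a P acc) ≤ visits κ β a + length acc
length-completions zero    zero    zero    P acc = ≤-refl
length-completions zero    zero    (suc a) P acc = m≤n⇒m≤1+n (length-completions zero zero a (pad P) acc)
length-completions zero    (suc β) a       P acc = m≤n⇒m≤1+n (length-completions zero β a (addZero P) acc)
length-completions (suc κ) zero    a       P acc = m≤n⇒m≤1+n (length-completions κ zero a (addToken P) acc)
length-completions (suc κ) (suc β) a       P acc = m≤n⇒m≤1+n (begin
  length (completions κ (suc β) a (addToken P) acc′)
    ≤⟨ length-completions κ (suc β) a (addToken P) acc′ ⟩
  visits κ (suc β) a + length acc′
    ≤⟨ +-monoʳ-≤ (visits κ (suc β) a) (length-completions (suc κ) β a (addZero P) acc) ⟩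
  visits κ (suc β) a + (visits (suc κ) β a + length acc)
    ≡⟨ trans (sym (+-assoc (visits κ (suc β) a) _ _)) (cong (_+ length acc) (+-comm (visits κ (suc β) a) _)) ⟩
  visits (suc κ) β a + visits κ (suc β) a + length acc ∎)
  where
  open ≤-Reasoning
  acc′ = completions (suc κ) β a (addZero P) acc

-- The exponent depends on `β` alone, which keeps the enumeration within n^O(d). Counting one node
-- extra turns the recursion at a branching node into a plain sum.
visits-bound : ∀ κ β a → suc (visits κ β a) ≤ (2 + κ) ^ suc β * suc a
visits-bound zero    zero    zero    = ≤-refl
visits-bound zero    zero    (suc a) = ≤-trans (s≤s (visits-bound zero zero a))
  (≤-trans (n≤1+n _) (≤-reflexive (sym (*-suc 2 (suc a)))))
visits-bound zero (suc β) a = begin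
  suc (suc (visits 0 β a))
    ≤⟨ +-mono-≤ (s≤s {n = visits 0 β a} z≤n) (≤-reflexive (sym (+-identityʳ (suc (visits 0 β a))))) ⟩
  2 * suc (visits 0 β a)      ≤⟨ *-monoʳ-≤ 2 (visits-bound 0 β a) ⟩
  2 * (2 ^ suc β * suc a)     ≡⟨ *-assoc 2 (2 ^ suc β) (suc a) ⟨
  2 ^ suc (suc β) * suc a     ∎
  where open ≤-Reasoning
visits-bound (suc κ) zero a = begin
  suc (suc (visits κ 0 a)) ≤⟨ +-mono-≤ (s≤s {n = a} z≤n) (visits-bound κ 0 a) ⟩
  suc a + (2 + κ) ^ 1 * suc a ≡⟨⟩
  suc ((2 + κ) ^ 1) * suc a ∎
  where open ≤-Reasoning
visits-bound (suc κ) (suc β) a = begin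
  suc (suc (visits (suc κ) β a + visits κ (suc β) a))
    ≡⟨ cong suc (sym (+-suc (visits (suc κ) β a) _)) ⟩
  suc (visits (suc κ) β a) + suc (visits κ (suc β) a)
    ≤⟨ +-mono-≤ (visits-bound (suc κ) β a) (visits-bound κ (suc β) a) ⟩
  (3 + κ) ^ suc β * suc a + (2 + κ) * (2 + κ) ^ suc β * suc a
    ≤⟨ +-monoʳ-≤ ((3 + κ) ^ suc β * suc a)
         (*-monoˡ-≤ (suc a) (*-monoʳ-≤ (2 + κ) (^-monoˡ-≤ (suc β) (n≤1+n (2 + κ))))) ⟩
  (3 + κ) ^ suc β * suc a + (2 + κ) * (3 + κ) ^ suc β * suc a
    ≡⟨ *-distribʳ-+ (suc a) ((3 + κ) ^ suc β) ((2 + κ) * (3 + κ) ^ suc β) ⟨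
  (3 + κ) ^ suc (suc β) * suc a ∎
  where open ≤-Reasoning

Item : ℕ → ℕ → Set
Item n k = ∃[ t ] ∃[ κ ] ∃[ β ] ∃[ a ] Partial n k t κ β a

-- The two letters of a token are stored with the entry, so `expand` need not distinguish the cases
-- of `t`.
⌜_⌝Partial : ∀ {n k t κ β a} → Partial n k t κ β a → Tree
⌜_⌝Partial {t = t} {κ} {β} {a} P =
  ⌜ word P ⌝word ∙ ⌜ κ ⌝ℕ ∙ ⌜ β ⌝ℕ ∙ ⌜ a ⌝ℕ ∙ ⌜ t ⌝Bool ∙ ⌜ not t ⌝Bool

⌜_⌝items : ∀ {n k} → List (Item n k) → Tree
⌜ [] ⌝items                        = nil
⌜ (_ , _ , _ , _ , P) ∷ is ⌝items = ⌜ P ⌝Partial ∙ ⌜ is ⌝items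

expandAll : ∀ {n k} → List (Item n k) → List (Vertex n k) → List (Vertex n k)
expandAll []                       acc = acc
expandAll ((_ , κ , β , a , P) ∷ is) acc = expandAll is (completions κ β a P acc)

visitsAll : ∀ {n k} → List (Item n k) → ℕ
visitsAll []                       = 0
visitsAll ((_ , κ , β , a , P) ∷ is) = visits κ β a + visitsAll is

length-expandAll : ∀ {n k} (is : List (Item n k)) acc →
                   length (expandAll is acc) ≤ visitsAll is + length acc
length-expandAll []                       acc = ≤-refl
length-expandAll ((_ , κ , β , a , P) ∷ is) acc = begin
  length (expandAll is acc′)              ≤⟨ length-expandAll is acc′ ⟩
  visitsAll is + length acc′              ≤⟨ +-monoʳ-≤ (visitsAll is) (length-completions κ β a P acc) ⟩
  visitsAll is + (visits κ β a + length acc) ≡⟨ +-assoc (visitsAll is) _ _ ⟨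
  visitsAll is + visits κ β a + length acc ≡⟨ cong (_+ length acc) (+-comm (visitsAll is) _) ⟩
  visits κ β a + visitsAll is + length acc ∎
  where
  open ≤-Reasoning
  acc′ = completions κ β a P acc

⌜zeros⌝ : ∀ l → ⌜ l ⌝ℕ ≡ ⌜ replicate l false ⌝word
⌜zeros⌝ zero    = refl
⌜zeros⌝ (suc l) = cong (nil ∙_) (⌜zeros⌝ l)

toks-zeros : ∀ {t} l → Tok t 0 l (replicate l false)
toks-zeros zero    = []
toks-zeros (suc l) = zer (toks-zeros l)

module _ {n k b : ℕ} where

  -- A window of length 2`k` + `b` with `a` letters before it and `l` letters after it.
  Fits : ℕ → ℕ → Set
  Fits a l = k * 2 + (b + (a + l)) ≡ n

  fits-shift : ∀ {a l} → Fits a (suc l) → Fits (suc a) l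
  fits-shift {a} {l} = subst (λ e → k * 2 + (b + e) ≡ n) (+-suc a l)

  sapling : ∀ t l a → Fits a l → Item n k
  sapling t l a fits = t , k , b , a , partial {word = replicate l false} (toks-zeros l) (+-identityʳ k)
    (trans (cong (λ x → k * 2 + (b + (a + x))) (length-replicate l)) fits)

  saplings : ∀ l a → Fits a l → List (Item n k) → List (Item n k)
  saplings l a fits is = sapling true l a fits ∷ sapling false l a fits ∷ is

  forest : ∀ l a → Fits a l → List (Item n k) → List (Item n k)
  forest zero    a fits is = saplings zero a fits is
  forest (suc l) a fits is = forest l (suc a) (fits-shift fits) (saplings (suc l) a fits is)

  plant-halts : ∀ {O} l a fits is {seen q r t u v} →
    Halts O (plant b) (suc l * 60 + 2)
      (store (⌜ n ⌝ℕ ∙ ⌜ k ⌝ℕ) ⌜ is ⌝items seen ⌜ suc l ⌝ℕ q r ⌜ a ⌝ℕ t u v)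
      (λ τ → ∃[ js ] τ ≡ (⌜ n ⌝ℕ ∙ ⌜ k ⌝ℕ) ∷ ⌜ forest l a fits is ⌝items ∷ seen ∷ js)
  plant-halts zero a fits is =
    iterate 58 (λ ()) (seq assign (seq assign (seq assign assign)))
      (_ , _ , while-false refl , ≤-refl , _ , refl)
  plant-halts {O} (suc l) a fits is {seen} {q} {r} {t} {u} {v} =
    iterate 58 (λ ()) (seq assign (seq assign (seq assign assign)))
      -- The block of zeros was pushed as the numeral held in `r₁`; `⌜zeros⌝` identifies the two
      -- encodings.
      (subst
            (λ w → Halts O (plant b) (suc l * 60 + 2)
              (store (⌜ n ⌝ℕ ∙ ⌜ k ⌝ℕ)
                ((w ∙ ⌜ k ⌝ℕ ∙ ⌜ b ⌝ℕ ∙ ⌜ a ⌝ℕ ∙ one! ∙ nil) ∙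
                 (w ∙ ⌜ k ⌝ℕ ∙ ⌜ b ⌝ℕ ∙ ⌜ a ⌝ℕ ∙ nil ∙ one!) ∙ ⌜ is ⌝items)
                seen ⌜ suc l ⌝ℕ q r ⌜ suc a ⌝ℕ t u v)
              (λ τ → ∃[ js ] τ ≡ (⌜ n ⌝ℕ ∙ ⌜ k ⌝ℕ) ∷ ⌜ forest (suc l) a fits is ⌝items ∷ seen ∷ js))
            (sym (⌜zeros⌝ (suc l)))
            (plant-halts l (suc a) (fits-shift fits) (saplings (suc l) a fits is)))

-- Correctness of the enumeration loop and of the pairwise comparison

-- The flag computed by compareSets, and the flag and the unread part of the
-- second colour computed by compareColours.
apart : ∀ {n} → Bool → Vec Bool n → Vec Bool n → Bool
apart f []          []          = f
apart f (false ∷ A) (y ∷ B)     = apart f A B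
apart f (true ∷ A)  (false ∷ B) = apart f A B
apart f (true ∷ A)  (true ∷ B)  = apart false A B

covered : Bool → ℕ → ℕ → Bool
covered f zero    j       = f
covered f (suc i) zero    = covered false i zero
covered f (suc i) (suc j) = covered f i j

surplus : ℕ → ℕ → ℕ
surplus zero    j       = j
surplus (suc i) zero    = surplus i zero
surplus (suc i) (suc j) = surplus i j

apart-sound : ∀ {n} f (A B : Vec Bool n) → apart f A B ≡ true → f ≡ true × Disjoint (toList A) (toList B)
apart-sound f []          []          eq = eq , []
apart-sound f (false ∷ A) (y ∷ B)     eq = let f≡ , d = apart-sound f A B eq in f≡ , refl ∷ d
apart-sound f (true ∷ A)  (false ∷ B) eq = let f≡ , d = apart-sound f A B eq in f≡ , refl ∷ d
apart-sound f (true ∷ A)  (true ∷ B)  eq with () , _ ← apart-sound false A B eq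

apart-complete : ∀ {n} f (A B : Vec Bool n) → Disjoint (toList A) (toList B) → apart f A B ≡ f
apart-complete f []          []          []          = refl
apart-complete f (false ∷ A) (y ∷ B)     (_ ∷ d)     = apart-complete f A B d
apart-complete f (true ∷ A)  (false ∷ B) (_ ∷ d)     = apart-complete f A B d

-- The flag survives only if `i` ≤ `j`, and the absence of a surplus means `j` ≤ `i`.
covered-sound : ∀ f i j → covered f i j ≡ true → surplus i j ≡ 0 → f ≡ true × i ≡ j
covered-sound f zero    zero    eq _ = eq , refl
covered-sound f (suc i) zero    eq z with () , _ ← covered-sound false i zero eq z
covered-sound f (suc i) (suc j) eq z = let f≡ , i≡j = covered-sound f i j eq z in f≡ , cong suc i≡j

covered-refl : ∀ f i → covered f i i ≡ f
covered-refl f zero    = refl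
covered-refl f (suc i) = covered-refl f i

surplus-refl : ∀ i → surplus i i ≡ 0
surplus-refl zero    = refl
surplus-refl (suc i) = surplus-refl i

compareSets-halts : ∀ {O n} f (A B : Vec Bool n) {z w x r s u v} →
  Halts O compareSets (n * 30 + 2) (store z w x ⌜ toList A ⌝word ⌜ toList B ⌝word r s ⌜ f ⌝Bool u v)
    (_≡ store z w x nil nil r s ⌜ apart f A B ⌝Bool u v)
compareSets-halts f []          []          = exactly 2 (while-false refl)
compareSets-halts f (false ∷ A) (y ∷ B)     =
  iterate 28 (λ ()) (seq (if-false refl assign) (seq assign assign)) (compareSets-halts f A B)
compareSets-halts f (true ∷ A)  (false ∷ B) =
  iterate 28 (λ ()) (seq (if-true (λ ()) (if-false refl assign)) (seq assign assign)) (compareSets-halts f A B)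
compareSets-halts f (true ∷ A)  (true ∷ B)  =
  iterate 28 (λ ()) (seq (if-true (λ ()) (if-true (λ ()) assign)) (seq assign assign)) (compareSets-halts false A B)

compareColours-halts : ∀ {O} f i j {z w x p q u v} →
  Halts O compareColours (i * 30 + 2) (store z w x p q ⌜ i ⌝ℕ ⌜ j ⌝ℕ ⌜ f ⌝Bool u v)
    (_≡ store z w x p q nil ⌜ surplus i j ⌝ℕ ⌜ covered f i j ⌝Bool u v)
compareColours-halts f zero    j       = exactly 2 (while-false refl)
compareColours-halts f (suc i) zero    =
  iterate 28 (λ ()) (seq (if-false refl assign) (seq assign assign)) (compareColours-halts false i zero)
compareColours-halts f (suc i) (suc j) =
  iterate 28 (λ ()) (seq (if-true (λ ()) assign) (seq assign assign)) (compareColours-halts f i j)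

Disjoint⇒Empty : ∀ {n} (A B : Vec Bool n) → Disjoint (toList A) (toList B) → Empty (A ∩ B)
Disjoint⇒Empty (x ∷ A) (y ∷ B) (xy ∷ d) (zero , p) with x ∧ y | xy
Disjoint⇒Empty (x ∷ A) (y ∷ B) (xy ∷ d) (zero , ()) | false | refl
Disjoint⇒Empty (x ∷ A) (y ∷ B) (xy ∷ d) (suc i , Vec.there p) = Disjoint⇒Empty A B d (i , p)

module _ {n k m : ℕ} (c : Colouring n k m) where

  private
    O = oracle c

  ⌜_⌝seen : List (Vertex n k) → Tree
  ⌜ [] ⌝seen     = nil
  ⌜ A ∷ xs ⌝seen = (⌜ bits A ⌝word ∙ ⌜ toℕ (c A) ⌝ℕ) ∙ ⌜ xs ⌝seen

  -- In continuation form: working off one entry is not a complete run of the loop, so its cost is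
  -- added to that of a given run from the rest of the stack.
  expand-halts : ∀ κ β a {t} (P : Partial n k t κ β a) acc {z S T Q} →
    (∀ js → Halts O expand T (z ∷ S ∷ ⌜ completions κ β a P acc ⌝seen ∷ js) Q) →
    ∀ js → Halts O expand (visits κ β a * 100 + T) (z ∷ (⌜ P ⌝Partial ∙ S) ∷ ⌜ acc ⌝seen ∷ js) Q
  expand-halts zero zero zero P acc {z} {S} {T} {Q} next js@(_ ∷ _ ∷ _ ∷ _ ∷ _ ∷ _ ∷ _ ∷ []) =
    iterate 98 (λ ()) (seq assign (seq assign (seq assign (seq assign (seq assign (seq assign
        (seq (if-false refl assign)
             (if-false refl (if-false refl (if-false refl (seq (query (done P , encoded , refl)) assign)))))))))))
      -- The reply is stored with the word that was built, while `⌜_⌝seen` reads the word off the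
      -- vertex; `bits-done` equates them.
      (subst (λ w → ∀ js → Halts O expand T (z ∷ S ∷ ((⌜ w ⌝word ∙ ⌜ toℕ (c (done P)) ⌝ℕ) ∙ ⌜ acc ⌝seen) ∷ js) Q)
            (bits-done P) next _)
    where
    encoded : ⌜ word P ⌝word ≡ ⌜ done P ⌝Vertex
    encoded = sym (trans (⌜⌝Subset-toList (set (done P))) (cong ⌜_⌝word (bits-done P)))
  expand-halts zero zero (suc a) P acc next (_ ∷ _ ∷ _ ∷ _ ∷ _ ∷ _ ∷ _ ∷ []) =
    iterate 98 (λ ()) (seq assign (seq assign (seq assign (seq assign (seq assign (seq assign
        (seq (if-false refl assign)
             (if-false refl (if-false refl (if-true (λ ()) assign))))))))))
      (expand-halts zero zero a (pad P) acc next _)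
  expand-halts zero (suc β) a P acc next (_ ∷ _ ∷ _ ∷ _ ∷ _ ∷ _ ∷ _ ∷ []) =
    iterate 98 (λ ()) (seq assign (seq assign (seq assign (seq assign (seq assign (seq assign
        (seq (if-false refl assign)
             (if-true (λ ()) assign))))))))
      (expand-halts zero β a (addZero P) acc next _)
  expand-halts (suc κ) zero a P acc next (_ ∷ _ ∷ _ ∷ _ ∷ _ ∷ _ ∷ _ ∷ []) =
    iterate 98 (λ ()) (seq assign (seq assign (seq assign (seq assign (seq assign (seq assign
        (seq (if-true (λ ()) assign)
             (if-false refl (if-true (λ ()) assign)))))))))
      (expand-halts κ zero a (addToken P) acc next _)
  expand-halts (suc κ) (suc β) a P acc {T = T} next (_ ∷ _ ∷ _ ∷ _ ∷ _ ∷ _ ∷ _ ∷ []) =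
    iterate 98 (λ ()) (seq assign (seq assign (seq assign (seq assign (seq assign (seq assign
        (seq (if-true (λ ()) assign)
             (if-true (λ ()) assign))))))))
      (halts-≤ (≤-reflexive regroup)
            (expand-halts (suc κ) β a (addZero P) acc
              (expand-halts κ (suc β) a (addToken P) (completions (suc κ) β a (addZero P) acc) next) _))
    where
    regroup : visits (suc κ) β a * 100 + (visits κ (suc β) a * 100 + T) ≡
              (visits (suc κ) β a + visits κ (suc β) a) * 100 + T
    regroup = trans (sym (+-assoc (visits (suc κ) β a * 100) _ T))
      (cong (_+ T) (sym (*-distribʳ-+ 100 (visits (suc κ) β a) _)))

  expandAll-halts : ∀ is acc {z} js →
    Halts O expand (visitsAll is * 100 + 2) (z ∷ ⌜ is ⌝items ∷ ⌜ acc ⌝seen ∷ js)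
      (λ τ → ∃[ js ] τ ≡ z ∷ nil ∷ ⌜ expandAll is acc ⌝seen ∷ js)
  expandAll-halts [] acc js = _ , _ , while-false refl , ≤-refl , js , refl
  expandAll-halts ((_ , κ , β , a , P) ∷ is) acc js =
    halts-≤ (≤-reflexive (trans (sym (+-assoc (visits κ β a * 100) _ 2))
              (cong (_+ 2) (sym (*-distribʳ-+ 100 (visits κ β a) _)))))
      (expand-halts κ β a P acc (expandAll-halts is (completions κ β a P acc)) js)

  Clash : Vertex n k → Vertex n k → Set
  Clash A B = Disjoint (bits A) (bits B) × c A ≡ c B

  Answer : Tree → Set
  Answer z = ∃[ e ] z ≡ ⌜_⌝Edge {c = c} e

  clash⇒answer : ∀ A B → Clash A B → Answer (⌜ bits A ⌝word ∙ ⌜ bits B ⌝word)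
  clash⇒answer A B (d , eq) =
    monochromaticEdge A B (Disjoint⇒Empty (set A) (set B) d) eq ,
    sym (cong₂ _∙_ (⌜⌝Subset-toList (set A)) (⌜⌝Subset-toList (set B)))

  compareTime : ℕ
  compareTime = 70 + (n * 30 + m * 30)

  -- A later clash may overwrite `io`, so what persists is that `io` holds some answer, not which
  -- one.
  Progress : Set → Tree → Tree → Set
  Progress E z z′ = (Answer z → Answer z′) × (E → Answer z′)

  compare-halts : ∀ A B {as x bs} z p q r s t u →
    Halts O compare compareTime
      (store z (⌜ A ∷ as ⌝seen) x p q r s t u (⌜ B ∷ bs ⌝seen))
      (λ τ → ∃[ z′ ] Progress (Clash A B) z z′ ×
        ∃[ p ] ∃[ q ] ∃[ r ] ∃[ s ] ∃[ t ] ∃[ u ]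
        τ ≡ store z′ (⌜ A ∷ as ⌝seen) x p q r s t u (⌜ B ∷ bs ⌝seen))
  compare-halts A B z p q r s t u =
    halts-≤ timeBound
    (seqʰ (exactly 4 assign) λ { _ refl →
     seqʰ (exactly 4 assign) λ { _ refl →
     seqʰ (exactly 4 assign) λ { _ refl →
     seqʰ (exactly 4 assign) λ { _ refl →
     seqʰ (exactly 2 assign) λ { _ refl →
     seqʰ (compareSets-halts true (set A) (set B)) λ { _ refl →
     seqʰ (compareColours-halts (apart true (set A) (set B)) i j) λ { _ refl →
     decide _ refl _ refl }}}}}}})
    where
    i = toℕ (c A)
    j = toℕ (c B)

    timeBound : 4 + (4 + (4 + (4 + (2 + (n * 30 + 2 + (i * 30 + 2 + 20)))))) ≤ compareTime
    timeBound = ≤-trans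
      (≤-reflexive (solve 2 (λ a b → con 18 :+ (a :+ con 2 :+ (b :+ con 2 :+ con 20)) :≡ con 42 :+ (a :+ b))
        refl (n * 30) (i * 30)))
      (+-mono-≤ (≤ᵇ⇒≤ 42 70 _) (+-monoʳ-≤ (n * 30) (*-monoˡ-≤ 30 (<⇒≤ (toℕ<n (c A))))))

    i≡j : Clash A B → i ≡ j
    i≡j (_ , eq) = cong toℕ eq

    -- The remainder and the flag are generalised to `σ` and `f`, so that splitting on them selects
    -- the branch of `report`.
    decide : ∀ σ → σ ≡ surplus i j → ∀ f → f ≡ covered (apart true (set A) (set B)) i j →
      ∀ {as x bs p q r u} →
      Halts O report 20
        (store z (⌜ A ∷ as ⌝seen) x p q r ⌜ σ ⌝ℕ ⌜ f ⌝Bool u (⌜ B ∷ bs ⌝seen))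
        (λ τ → ∃[ z′ ] Progress (Clash A B) z z′ ×
          ∃[ p ] ∃[ q ] ∃[ r ] ∃[ s ] ∃[ t ] ∃[ u ]
          τ ≡ store z′ (⌜ A ∷ as ⌝seen) x p q r s t u (⌜ B ∷ bs ⌝seen))
    decide (suc σ) σ≡ f f≡ =
      _ , _ , if-true (λ ()) assign , ≤ᵇ⇒≤ _ 20 _ , z ,
      (id , λ clash → contradiction
        (trans σ≡ (trans (cong (surplus i) (sym (i≡j clash))) (surplus-refl i))) λ ()) ,
      _ , _ , _ , _ , _ , _ , refl
    decide zero σ≡ true f≡
      with apart≡ , i≡ ← covered-sound (apart true (set A) (set B)) i j (sym f≡) (sym σ≡) =
      _ , _ , if-false refl (if-true (λ ()) assign) , ≤ᵇ⇒≤ _ 20 _ , _ ,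
      ((λ _ → answer) , (λ _ → answer)) ,
      _ , _ , _ , _ , _ , _ , refl
      where
      answer : Answer (⌜ bits A ⌝word ∙ ⌜ bits B ⌝word)
      answer = clash⇒answer A B (proj₂ (apart-sound true (set A) (set B) apart≡) , toℕ-injective i≡)
    decide zero σ≡ false f≡ =
      _ , _ , if-false refl (if-false refl assign) , ≤ᵇ⇒≤ _ 20 _ , z ,
      (id , λ clash → contradiction
        (trans f≡ (trans (cong (covered (apart true (set A) (set B)) i) (sym (i≡j clash)))
          (trans (covered-refl _ i) (apart-complete true (set A) (set B) (proj₁ clash))))) λ ()) ,
      _ , _ , _ , _ , _ , _ , refl

  scanTime : ℕ → ℕ
  scanTime l = l * (5 + compareTime) + 2

  scan-halts : ∀ A bs {as x} z p q r s t u →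
    Halts O scan (scanTime (length bs))
      (store z (⌜ A ∷ as ⌝seen) x p q r s t u (⌜ bs ⌝seen))
      (λ τ → ∃[ z′ ] Progress (Any (Clash A) bs) z z′ ×
        ∃[ js ] τ ≡ z′ ∷ ⌜ A ∷ as ⌝seen ∷ x ∷ js)
  scan-halts A [] z p q r s t u =
    _ , _ , while-false refl , ≤-refl , z , (id , λ ()) , _ , refl
  scan-halts A (B ∷ bs) z p q r s t u
    with compare-halts A B z p q r s t u
  ... | _ , _ , run , le , z₁ , (keep₁ , find₁) , p₁ , q₁ , r₁ , s₁ , t₁ , u₁ , refl
    with scan-halts A bs z₁ p₁ q₁ r₁ s₁ t₁ u₁
  ... | _ , _ , run′ , le′ , z₂ , (keep₂ , find₂) , js , refl =
    _ , _ , while-true (λ ()) (seq run assign) run′ ,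
    ≤-trans (+-mono-≤ (+-monoʳ-≤ 2 (+-monoˡ-≤ 3 le)) le′)
      (≤-reflexive (timeBound compareTime (length bs * (5 + compareTime)))) ,
    z₂ , (keep₂ ∘ keep₁ , λ { (here clash) → keep₂ (find₁ clash) ; (there clash) → find₂ clash }) , js , refl
    where
    timeBound : ∀ x l → 2 + (x + 3) + (l + 2) ≡ 5 + x + l + 2
    timeBound = solve 2 (λ x l → con 2 :+ (x :+ con 3) :+ (l :+ con 2) :≡ con 5 :+ x :+ l :+ con 2) refl

  search-halts : ∀ as xs z js →
    Halts O search (length as * (7 + scanTime (length xs)) + 2)
      (z ∷ ⌜ as ⌝seen ∷ ⌜ xs ⌝seen ∷ js)
      (λ τ → ∃[ z′ ] Progress (Any (λ A → Any (Clash A) xs) as) z z′ × ∃[ js ] τ ≡ z′ ∷ js)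
  search-halts [] xs z js = _ , _ , while-false refl , ≤-refl , z , (id , λ ()) , _ , refl
  search-halts (A ∷ as) xs z (p ∷ q ∷ r ∷ s ∷ t ∷ u ∷ v ∷ [])
    with scan-halts A xs {as} {⌜ xs ⌝seen} z p q r s t u
  ... | _ , _ , run , le , z₁ , (keep₁ , find₁) , js₁ , refl
    with search-halts as xs z₁ js₁
  ... | _ , _ , run′ , le′ , z₂ , (keep₂ , find₂) , js₂ , refl =
    _ , _ , while-true (λ ()) (seq assign (seq run assign)) run′ ,
    ≤-trans (+-mono-≤ (+-monoʳ-≤ 4 (+-monoˡ-≤ 3 le)) le′)
      (≤-reflexive (timeBound (scanTime (length xs)) (length as * (7 + scanTime (length xs))))) ,
    z₂ , (keep₂ ∘ keep₁ , λ { (here clash) → keep₂ (find₁ clash) ; (there clash) → find₂ clash }) , js₂ , refl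
    where
    timeBound : ∀ x l → 4 + (x + 3) + (l + 2) ≡ 7 + x + l + 2
    timeBound = solve 2 (λ x l → con 4 :+ (x :+ con 3) :+ (l :+ con 2) :≡ con 7 :+ x :+ l :+ con 2) refl

-- Completeness of the enumeration

Hit : ∀ {n k} → List Bool → List (Vertex n k) → Set
Hit x = Any λ A → bits A ≡ x

Reaches : ∀ {n k t κ β a} → List Bool → Partial n k t κ β a → Set
Reaches {κ = κ} {β} {a} x P = ∀ acc → Hit x (completions κ β a P acc)

ItemReaches : ∀ {n k} → List Bool → Item n k → Set
ItemReaches x (_ , _ , _ , _ , P) = Reaches x P

module _ {n k : ℕ} where

  completions-keep : ∀ {x t} κ β a (P : Partial n k t κ β a) {acc} → Hit x acc → Hit x (completions κ β a P acc)
  completions-keep zero    zero    zero    P hit = there hit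
  completions-keep zero    zero    (suc a) P hit = completions-keep zero zero a (pad P) hit
  completions-keep zero    (suc β) a       P hit = completions-keep zero β a (addZero P) hit
  completions-keep (suc κ) zero    a       P hit = completions-keep κ zero a (addToken P) hit
  completions-keep (suc κ) (suc β) a       P hit =
    completions-keep κ (suc β) a (addToken P) (completions-keep (suc κ) β a (addZero P) hit)

  reaches-token : ∀ {x t} κ β a (P : Partial n k t (suc κ) β a) →
    Reaches x (addToken P) → Reaches x P
  reaches-token κ zero    a P hit acc = hit acc
  reaches-token κ (suc β) a P hit acc = hit _

  reaches-zero : ∀ {x t} κ β a (P : Partial n k t κ (suc β) a) →
    Reaches x (addZero P) → Reaches x P
  reaches-zero zero    β a P hit acc = hit acc
  reaches-zero (suc κ) β a P hit acc = completions-keep κ (suc β) a (addToken P) (hit acc)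

  -- Words grow from right to left, so the rest of `y` is put in first and its first token last. The
  -- leftover budgets `κ` and `β` are arbitrary so that the induction can spend from them.
  reaches-toks : ∀ {t κ₁ β₁ y κ₂ β₂ κ β a} → Tok t κ₁ β₁ y → κ₂ ≡ κ₁ + κ → β₂ ≡ β₁ + β →
    (P : Partial n k t κ₂ β₂ a) →
    ∃ λ (P′ : Partial n k t κ β a) → word P′ ≡ y ++ word P × (∀ x → Reaches x P′ → Reaches x P)
  reaches-toks [] refl refl P = P , refl , λ _ → id
  reaches-toks {κ = κ} {β} {a} (one {κ = κ₁} tok) eκ eβ P with reaches-toks tok (trans eκ (sym (+-suc κ₁ κ))) eβ P
  ... | P′ , eq , via = addToken P′ , cong (λ y → _ ∷ _ ∷ y) eq ,
    λ x → via x ∘ reaches-token κ β a P′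
  reaches-toks {κ = κ} {β} {a} (zer {ζ = β₁} tok) eκ eβ P with reaches-toks tok eκ (trans eβ (sym (+-suc β₁ β))) P
  ... | P′ , eq , via = addZero P′ , cong (false ∷_) eq ,
    λ x → via x ∘ reaches-zero κ β a P′

  replicate-snoc : ∀ a (y : List Bool) → replicate a false ++ false ∷ y ≡ false ∷ (replicate a false ++ y)
  replicate-snoc zero    y = refl
  replicate-snoc (suc a) y = cong (false ∷_) (replicate-snoc a y)

  reaches-padded : ∀ {t} a (P : Partial n k t 0 0 a) → Reaches (replicate a false ++ word P) P
  reaches-padded zero    P acc = here (bits-done P)
  reaches-padded (suc a) P acc =
    subst (λ x → Hit x (completions 0 0 a (pad P) acc)) (replicate-snoc a (word P)) (reaches-padded a (pad P) acc)

  reaches-word : ∀ {t κ β y a} → Tok t κ β y → (P : Partial n k t κ β a) →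
    Reaches (replicate a false ++ (y ++ word P)) P
  reaches-word {a = a} tok P with reaches-toks tok (sym (+-identityʳ _)) (sym (+-identityʳ _)) P
  ... | P′ , eq , via = via _
    (subst (λ y → Reaches (replicate a false ++ y) P′) eq (reaches-padded a P′))

  expandAll-keep : ∀ {x} is {acc : List (Vertex n k)} → Hit x acc → Hit x (expandAll is acc)
  expandAll-keep []                         hit = hit
  expandAll-keep ((_ , κ , β , a , P) ∷ is) hit = expandAll-keep is (completions-keep κ β a P hit)

  expandAll-hit : ∀ {x} is acc → Any (ItemReaches {n} {k} x) is → Hit x (expandAll is acc)
  expandAll-hit (_ ∷ is) acc (here hit)   = expandAll-keep is (hit acc)
  expandAll-hit (_ ∷ is) acc (there hits) = expandAll-hit is _ hits

module _ {n k b : ℕ} where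

  saplings-reach : ∀ {t y} l a fits is → Tok t k b y →
    Any (ItemReaches (replicate a false ++ (y ++ replicate l false))) (saplings {n} {k} {b} l a fits is)
  saplings-reach {true}  l a fits is tok = here (reaches-word tok _)
  saplings-reach {false} l a fits is tok = there (here (reaches-word tok _))

  forest-keep : ∀ {P : Item n k → Set} l a fits is → Any P is → Any P (forest {n} {k} {b} l a fits is)
  forest-keep zero    a fits is any = there (there any)
  forest-keep (suc l) a fits is any =
    forest-keep l (suc a) (fits-shift {n} {k} {b} {a} {l} fits) _ (there (there any))

  forest-reach : ∀ {t y} j l a a′ l′ fits is → Tok t k b y → j + l′ ≡ l → a′ ≡ a + j →
    Any (ItemReaches (replicate a′ false ++ (y ++ replicate l′ false))) (forest {n} {k} {b} l a fits is)
  forest-reach zero zero a a′ l′ fits is tok refl a′≡ rewrite trans a′≡ (+-identityʳ a) =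
    saplings-reach zero a fits is tok
  forest-reach zero (suc l) a a′ l′ fits is tok refl a′≡ rewrite trans a′≡ (+-identityʳ a) =
    forest-keep l (suc a) (fits-shift {n} {k} {b} {a} {l} fits) _ (saplings-reach (suc l) a fits is tok)
  forest-reach (suc j) (suc l) a a′ l′ fits is tok eq a′≡ =
    forest-reach j l (suc a) a′ l′ (fits-shift {n} {k} {b} {a} {l} fits) _ tok
      (suc-injective eq) (trans a′≡ (+-suc a j))

-- Blocks, and the lower bound on the number of colours

Disjoint-zerosˡ : ∀ c {ys} → c ≡ length ys → Disjoint (replicate c false) ys
Disjoint-zerosˡ zero    {[]}     _  = []
Disjoint-zerosˡ (suc c) {_ ∷ ys} eq = refl ∷ Disjoint-zerosˡ c (suc-injective eq)

Disjoint-shifted : ∀ a x c a′ {ys} → a + length x ≤ a′ →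
  length (replicate a false ++ (x ++ replicate c false)) ≡ length (replicate a′ false ++ ys) →
  Disjoint (replicate a false ++ (x ++ replicate c false)) (replicate a′ false ++ ys)
Disjoint-shifted (suc a) x       c (suc a′) (s≤s le) eq = refl ∷ Disjoint-shifted a x c a′ le (suc-injective eq)
Disjoint-shifted zero    (y ∷ x) c (suc a′) (s≤s le) eq =
  ∧-zeroʳ y ∷ Disjoint-shifted zero x c a′ le (suc-injective eq)
Disjoint-shifted zero    []      c a′       le       eq = Disjoint-zerosˡ c (trans (sym (length-replicate c)) eq)

Disjoint-padded : ∀ a c {x y} → Disjoint x y →
  Disjoint (replicate a false ++ (x ++ replicate c false)) (replicate a false ++ (y ++ replicate c false))
Disjoint-padded a c d = Pointwise.++⁺ (zeros a) (Pointwise.++⁺ d (zeros c))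
  where
  zeros : ∀ a → Disjoint (replicate a false) (replicate a false)
  zeros a = Disjoint-zerosˡ a (sym (length-replicate a))

module _ {n k m : ℕ} (c : Colouring n k m) where

  -- Colours are shifted by one because 0 marks words that are not in the list.
  colourAt : List (Vertex n k) → List Bool → ℕ
  colourAt []       x = 0
  colourAt (A ∷ xs) x with ≡-dec Bool._≟_ (bits A) x
  ... | yes _ = suc (toℕ (c A))
  ... | no  _ = colourAt xs x

  colourAt-sound : ∀ xs x → 0 < colourAt xs x →
    ∃[ A ] A ∈ˡ xs × bits A ≡ x × suc (toℕ (c A)) ≡ colourAt xs x
  colourAt-sound (A ∷ xs) x pos with ≡-dec Bool._≟_ (bits A) x
  ... | yes eq = A , here refl , eq , refl
  ... | no  _  = let B , B∈xs , eq , col = colourAt-sound xs x pos in B , there B∈xs , eq , col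

  colourAt-positive : ∀ {x} xs → Hit x xs → 0 < colourAt xs x
  colourAt-positive {x} (A ∷ xs) hit with ≡-dec Bool._≟_ (bits A) x | hit
  ... | yes _ | _          = s≤s z≤n
  ... | no ne | here eq    = contradiction eq ne
  ... | no _  | there hit′ = colourAt-positive xs hit′

  clash? : ∀ A B → Dec (Clash c A B)
  clash? A B = Pointwise.decidable (λ a b → (a ∧ b) Bool.≟ false) (bits A) (bits B) ×-dec (c A Fin.≟ c B)

module Blocks {n k′ b m : ℕ} (c : Colouring n (suc k′) m) (xs : List (Vertex n (suc k′))) (N : ℕ)
  (fit : N * (suc k′ * 2 + b) ≤ n)
  (hits : ∀ {t y} a l → Tok t (suc k′) b y → suc k′ * 2 + (b + (a + l)) ≡ n →
          Hit (replicate a false ++ (y ++ replicate l false)) xs)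
  (noClash : ¬ Any (λ A → Any (Clash c A) xs) xs)
  where

  L = suc k′ * 2 + b

  padding : ℕ → ℕ
  padding j = n ∸ (L + j * L)

  padding-fits : ∀ (j : Fin N) → L + (toℕ j * L + padding (toℕ j)) ≡ n
  padding-fits j = trans (sym (+-assoc L (toℕ j * L) _)) (m+[n∸m]≡n (≤-trans (*-monoˡ-≤ L (toℕ<n j)) fit))

  inBlock : ℕ → List Bool → List Bool
  inBlock j x = replicate (j * L) false ++ (x ++ replicate (padding j) false)

  noClash′ : ∀ {A B} → A ∈ˡ xs → B ∈ˡ xs → ¬ Clash c A B
  noClash′ A∈xs B∈xs clash = noClash (lose A∈xs (lose B∈xs clash))

  colourIn : ℕ → Vec Bool L → ℕ
  colourIn j w = colourAt c xs (inBlock j (toList w))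

  colourIn-covers : ∀ (j : Fin N) t w → Tok t (suc k′) b (toList w) → 0 < colourIn (toℕ j) w
  colourIn-covers j t w tok = colourAt-positive c xs
    (hits (toℕ j * L) (padding (toℕ j)) tok (trans (sym (+-assoc (suc k′ * 2) b _)) (padding-fits j)))

  colourIn-proper : ∀ j w w′ → 0 < colourIn j w → 0 < colourIn j w′ →
                    Disjoint (toList w) (toList w′) → colourIn j w ≢ colourIn j w′
  colourIn-proper j w w′ pos pos′ d eq
    with A , A∈xs , bitsA , colA ← colourAt-sound c xs (inBlock j (toList w)) pos
       | B , B∈xs , bitsB , colB ← colourAt-sound c xs (inBlock j (toList w′)) pos′ =
    noClash′ A∈xs B∈xs
      ( subst₂ Disjoint (sym bitsA) (sym bitsB) (Disjoint-padded (j * L) (padding j) d)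
      , toℕ-injective (suc-injective (trans colA (trans eq (sym colB)))))

  abstract
    climbIn : ∀ (j : Fin N) → Climb (λ v → ∃[ w ] colourIn (toℕ j) w ≡ v) 0 (2 + b)
    climbIn j = colourful k′ b (colourIn (toℕ j)) (colourIn-covers j) (colourIn-proper (toℕ j))

  Witness : Fin N → Fin (2 + b) → Set
  Witness j i = ∃[ A ] A ∈ˡ xs × ∃[ w ]
    bits A ≡ inBlock (toℕ j) (toList {n = L} w) × suc (toℕ (c A)) ≡ at (climbIn j) i

  abstract
    vertexAt : ∀ j i → Witness j i
    vertexAt j i =
      let w , eq = at-P (climbIn j) i
          A , A∈xs , bitsA , colA = colourAt-sound c xs (inBlock (toℕ j) (toList w))
                                      (subst (0 <_) (sym eq) (at-> (climbIn j) i))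
      in A , A∈xs , w , bitsA , trans colA eq

  -- Sets in different blocks are disjoint, so a shared colour would be a clash.
  different : ∀ {j j′ : Fin N} {A B} {w w′ : Vec Bool L} → toℕ j < toℕ j′ → A ∈ˡ xs → B ∈ˡ xs →
              bits A ≡ inBlock (toℕ j) (toList w) → bits B ≡ inBlock (toℕ j′) (toList w′) → c A ≢ c B
  different {j} {j′} {A} {B} {w} {w′} lt A∈xs B∈xs bitsA bitsB eq = noClash′ A∈xs B∈xs
    ( subst₂ Disjoint (sym bitsA) (sym bitsB)
        (Disjoint-shifted (toℕ j * L) (toList w) (padding (toℕ j)) (toℕ j′ * L)
          (≤-trans (≤-reflexive (trans (cong (toℕ j * L +_) (length-toList w)) (+-comm _ L))) (*-monoˡ-≤ L lt))
          (trans (sym (cong length bitsA)) (trans (length-toList (set A))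
            (trans (sym (length-toList (set B))) (cong length bitsB)))))
    , eq)


  colour : Fin N → Fin (2 + b) → Fin m
  colour j i = c (proj₁ (vertexAt j i))

  colour-injective : ∀ j i j′ i′ → colour j i ≡ colour j′ i′ → (j , i) ≡ (j′ , i′)
  colour-injective j i j′ i′ eq = go (vertexAt j i) (vertexAt j′ i′) eq
    where
    go : (u : Witness j i) (v : Witness j′ i′) → c (proj₁ u) ≡ c (proj₁ v) → (j , i) ≡ (j′ , i′)
    go (A , A∈xs , w , bitsA , colA) (B , B∈xs , w′ , bitsB , colB) eq with <-cmp (toℕ j) (toℕ j′)
    ... | tri< lt _ _ = contradiction eq (different lt A∈xs B∈xs bitsA bitsB)
    ... | tri> _ _ gt = contradiction (sym eq) (different gt B∈xs A∈xs bitsB bitsA)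
    ... | tri≈ _ j≡ _ with refl ← toℕ-injective j≡ =
      cong (j ,_) (at-injective (climbIn j) i i′ (trans (sym colA) (trans (cong (suc ∘ toℕ) eq) colB)))

  -- There is one colour for each block and each rank of its climb. These are distinct, so the
  -- pigeonhole principle excludes a smaller `m`.
  manyColours : (2 + b) * N ≤ m
  manyColours = ≮⇒≥ λ m<dN →
    let x , y , x<y , eq = pigeonhole m<dN λ x →
          colour (proj₂ (remQuot {2 + b} N x)) (proj₁ (remQuot {2 + b} N x))
        pairs = colour-injective _ _ _ _ eq
    in Fin.<⇒≢ x<y (begin
         x ≡⟨ combine-remQuot {2 + b} N x ⟨
         uncombine x ≡⟨ cong (λ (j , i) → combine i j) pairs ⟩
         uncombine y ≡⟨ combine-remQuot {2 + b} N y ⟩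
         y ∎)
    where
    open ≡-Reasoning
    uncombine : Fin ((2 + b) * N) → Fin ((2 + b) * N)
    uncombine x = combine (proj₁ (remQuot {2 + b} N x)) (proj₂ (remQuot {2 + b} N x))

-- Size of the enumeration and termination of the whole program

visitsAll-forest : ∀ {n k b} l a fits is {x} → a + l ≤ x →
  visitsAll (forest {n} {k} {b} l a fits is) ≤ suc l * (2 * ((2 + k) ^ suc b * suc x)) + visitsAll is
visitsAll-saplings : ∀ {n k b} l a fits is {x} → a ≤ x →
  visitsAll (saplings {n} {k} {b} l a fits is) ≤ 2 * ((2 + k) ^ suc b * suc x) + visitsAll is

visitsAll-saplings {n} {k} {b} l a fits is {x} a≤x = begin
  o + (o + visitsAll is) ≤⟨ +-mono-≤ o≤B (+-monoˡ-≤ (visitsAll is) o≤B) ⟩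
  B + (B + visitsAll is) ≡⟨ +-assoc B B _ ⟨
  B + B + visitsAll is   ≡⟨ cong (λ y → B + y + visitsAll is) (+-identityʳ B) ⟨
  2 * B + visitsAll is   ∎
  where
  open ≤-Reasoning
  o = visits k b a
  B = (2 + k) ^ suc b * suc x
  o≤B : o ≤ B
  o≤B = ≤-trans (n≤1+n o) (≤-trans (visits-bound k b a) (*-monoʳ-≤ ((2 + k) ^ suc b) (s≤s a≤x)))

visitsAll-forest zero a fits is le =
  ≤-trans (visitsAll-saplings zero a fits is (≤-trans (m≤m+n a 0) le))
    (≤-reflexive (cong (_+ visitsAll is) (sym (+-identityʳ _))))
visitsAll-forest {n} {k} {b} (suc l) a fits is {x} le = begin
  visitsAll (forest l (suc a) (fits-shift {n} {k} {b} {a} {l} fits) (saplings (suc l) a fits is))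
    ≤⟨ visitsAll-forest l (suc a) (fits-shift {n} {k} {b} {a} {l} fits) _
         (≤-trans (≤-reflexive (sym (+-suc a l))) le) ⟩
  suc l * B₂ + visitsAll (saplings {n} {k} {b} (suc l) a fits is)
    ≤⟨ +-monoʳ-≤ (suc l * B₂) (visitsAll-saplings (suc l) a fits is (≤-trans (m≤m+n a _) le)) ⟩
  suc l * B₂ + (B₂ + visitsAll is) ≡⟨ +-assoc (suc l * B₂) B₂ _ ⟨
  suc l * B₂ + B₂ + visitsAll is   ≡⟨ cong (_+ visitsAll is) (+-comm (suc l * B₂) B₂) ⟩
  suc (suc l) * B₂ + visitsAll is  ∎
  where
  open ≤-Reasoning
  B₂ = 2 * ((2 + k) ^ suc b * suc x)

module _ {n k m : ℕ} (c : Colouring n k m) {b x : ℕ} (fits : Fits {n} {k} {b} 0 x) where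

  startItems : List (Item n k)
  startItems = forest x 0 fits []

  candidates : List (Vertex n k)
  candidates = expandAll startItems []

  totalTime : ℕ
  totalTime = 5 + (3 + ((k * 20 + 2) + (2 + ((b * 20 + 2) + ((suc x * 60 + 2) +
    ((visitsAll startItems * 100 + 2) + (2 +
      (length candidates * (7 + scanTime c (length candidates)) + 2))))))))

  bruteForce-halts :
    Halts (oracle c) (bruteForce b) totalTime
      (store (⌜ n ⌝ℕ ∙ ⌜ k ⌝ℕ) nil nil nil nil nil nil nil nil nil)
      (λ τ → ∃[ z ] (Any (λ A → Any (Clash c A) candidates) candidates → Answer c z) × ∃[ js ] τ ≡ z ∷ js)
  bruteForce-halts =
    seqʰ (exactly 5 assign) λ { _ refl →
    seqʰ (exactly 3 assign) λ { _ refl →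
    seqʰ (subst (λ l → Halts (oracle c) stripKeys (k * 20 + 2)
            (store (⌜ n ⌝ℕ ∙ ⌜ k ⌝ℕ) nil nil ⌜ l ⌝ℕ ⌜ k ⌝ℕ nil nil nil nil nil)
            (_≡ store (⌜ n ⌝ℕ ∙ ⌜ k ⌝ℕ) nil nil ⌜ b + suc x ⌝ℕ nil nil nil nil nil nil))
            lengths (stripKeys-halts k (b + suc x))) λ { _ refl →
    seqʰ (exactly 2 assign) λ { _ refl →
    seqʰ (stripSlack-halts b (suc x)) λ { _ refl →
    seqʰ (plant-halts x 0 fits []) λ { _ (js , refl) →
    seqʰ (expandAll-halts c startItems [] js) λ { _ (_ ∷ _ ∷ _ ∷ _ ∷ _ ∷ _ ∷ _ ∷ [] , refl) →
    seqʰ (exactly 2 assign) λ { _ refl →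
    finish (search-halts c candidates candidates _ _) }}}}}}}}
    where
    lengths : k * 2 + (b + suc x) ≡ suc n
    lengths = trans (cong (k * 2 +_) (+-suc b x)) (trans (+-suc (k * 2) (b + x)) (cong suc fits))
    -- Initially `io` holds the input, so only the half of `Progress` that turns a clash into an
    -- answer is kept.
    finish : ∀ {p T σ z E} → Halts (oracle c) p T σ (λ τ → ∃[ z′ ] Progress c E z z′ × ∃[ js ] τ ≡ z′ ∷ js) →
             Halts (oracle c) p T σ (λ τ → ∃[ z′ ] (E → Answer c z′) × ∃[ js ] τ ≡ z′ ∷ js)
    finish (τ , t , run , le , z′ , (_ , find) , js , eq) = τ , t , run , le , z′ , find , js , eq

-- Running time

module Growth (n d : ℕ) (2≤n : 2 ≤ n) .{{_ : NonZero d}} where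

  infix 4 _≼_

  -- Bounds of the form n^O(d), with the exponent counted in multiples of `d`. Being a record, it
  -- lets `a` be read off from the type.
  record _≼_ (x a : ℕ) : Set where
    constructor bounded
    field bound : x ≤ n ^ (a * d)

  open _≼_ public

  private instance
    n-nonZero : NonZero n
    n-nonZero = >-nonZero (≤-trans (s≤s z≤n) 2≤n)

  ≤-≼ : ∀ {x y a} → x ≤ y → y ≼ a → x ≼ a
  ≤-≼ x≤y (bounded p) = bounded (≤-trans x≤y p)

  ≼-≤ : ∀ {x a b} → a ≤ b → x ≼ a → x ≼ b
  ≼-≤ a≤b (bounded p) = bounded (≤-trans p (^-monoʳ-≤ n (*-monoˡ-≤ d a≤b)))

  ≼-power : ∀ {x} a → x ≤ n ^ a → x ≼ a
  ≼-power a le = bounded (≤-trans le (^-monoʳ-≤ n (m≤m*n a d)))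

  ≼-const : ∀ {x} a → x ≤ 2 ^ a → x ≼ a
  ≼-const a le = ≼-power a (≤-trans le (^-monoˡ-≤ a 2≤n))

  ≼-linear : ∀ {x} → x ≤ n → x ≼ 1
  ≼-linear le = ≼-power 1 (≤-trans le (≤-reflexive (sym (^-identityʳ n))))

  ≼-* : ∀ {x y a b} → x ≼ a → y ≼ b → x * y ≼ a + b
  ≼-* {x} {y} {a} {b} (bounded p) (bounded q) = bounded (begin
    x * y                     ≤⟨ *-mono-≤ p q ⟩
    n ^ (a * d) * n ^ (b * d) ≡⟨ ^-distribˡ-+-* n (a * d) (b * d) ⟨
    n ^ (a * d + b * d)       ≡⟨ cong (n ^_) (*-distribʳ-+ d a b) ⟨
    n ^ ((a + b) * d)         ∎)
    where open ≤-Reasoning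

  -- A sum is at most twice the larger bound, and 2 ≤ `n` turns the factor two into one more unit of
  -- the exponent.
  ≼-+ : ∀ {x y a b} → x ≼ a → y ≼ b → x + y ≼ 1 + (a ⊔ b)
  ≼-+ {a = a} {b} p q = ≤-≼
    (+-mono-≤ (bound (≼-≤ (m≤m⊔n a b) p))
      (≤-trans (bound (≼-≤ (m≤n⊔m a b) q)) (≤-reflexive (sym (+-identityʳ _)))))
    (≼-* (≼-const 1 ≤-refl) (bounded {a = a ⊔ b} ≤-refl))

  ≼-+2 : ∀ {x a} → x ≼ a → x + 2 ≼ 1 + (a ⊔ 1)
  ≼-+2 p = ≼-+ p (≼-const 1 ≤-refl)

-- The search accounts for 23, and each of the eight outer additions in `totalTime` for one more.
exponent : ℕ
exponent = 31

-- Colours are compared in unary, so their number enters the running time.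
totalTime-bound : ∀ {n k m} (c : Colouring n (suc k) m) {b x} (fits : Fits {n} {suc k} {b} 0 x) →
  m ≤ n * n → totalTime c {b} {x} fits ≤ n ^ (exponent * (2 + b))
totalTime-bound {n} {k} {m} c {b} {x} fits m≤n² = bound {a = exponent} total
  where
  5≤8 = ≤ᵇ⇒≤ 5 8 _
  3≤4 = ≤ᵇ⇒≤ 3 4 _
  7≤8 = ≤ᵇ⇒≤ 7 8 _
  20≤32 = ≤ᵇ⇒≤ 20 32 _
  30≤32 = ≤ᵇ⇒≤ 30 32 _
  60≤64 = ≤ᵇ⇒≤ 60 64 _
  70≤128 = ≤ᵇ⇒≤ 70 128 _
  100≤128 = ≤ᵇ⇒≤ 100 128 _
  K≤n : suc k * 2 + b ≤ n
  K≤n = ≤-trans (+-monoʳ-≤ (suc k * 2) (m≤m+n b x)) (≤-reflexive fits)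
  2≤n : 2 ≤ n
  2≤n = ≤-trans (s≤s (s≤s z≤n)) K≤n
  open Growth n (2 + b) 2≤n
  k<n : suc k ≤ n
  k<n = ≤-trans (m≤m*n (suc k) 2) (≤-trans (m≤m+n _ b) K≤n)
  k≼ : suc k ≼ 1
  k≼ = ≼-linear k<n
  b≼ : b ≼ 1
  b≼ = ≼-linear (≤-trans (m≤n+m b (suc k * 2)) K≤n)
  x<n : suc x ≤ n
  x<n = ≤-trans (s≤s (m≤n+m x (suc (k * 2) + b))) (≤-reflexive (trans (cong suc (+-assoc (suc (k * 2)) b x)) fits))
  x≼ : suc x ≼ 1
  x≼ = ≼-linear x<n
  m≼ : m ≼ 2
  m≼ = ≼-power 2 (≤-trans m≤n² (≤-reflexive (cong (n *_) (sym (*-identityʳ n)))))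
  3+k≤n² : 3 + k ≤ n ^ 2
  3+k≤n² = begin
    2 + suc k ≤⟨ +-mono-≤ 2≤n k<n ⟩
    n + n     ≡⟨ cong (n +_) (+-identityʳ n) ⟨
    2 * n     ≤⟨ *-mono-≤ 2≤n (≤-reflexive (sym (*-identityʳ n))) ⟩
    n ^ 2     ∎
    where open ≤-Reasoning
  -- The only factor whose exponent grows with `b`. Since 3 + `k` is at most the square of `n`, two
  -- units suffice.
  power≼ : (3 + k) ^ suc b ≼ 2
  power≼ = bounded (begin
    (3 + k) ^ suc b  ≤⟨ ^-monoˡ-≤ (suc b) 3+k≤n² ⟩
    (n ^ 2) ^ suc b  ≡⟨ ^-*-assoc n 2 (suc b) ⟩
    n ^ (2 * suc b)  ≤⟨ ^-monoʳ-≤ n {{>-nonZero (≤-trans (s≤s z≤n) 2≤n)}} (*-monoʳ-≤ 2 (n≤1+n (suc b))) ⟩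
    n ^ (2 * (2 + b)) ∎)
    where open ≤-Reasoning
  visits≼ : visitsAll (startItems c {b} {x} fits) ≼ 5
  visits≼ = ≤-≼ (≤-trans (visitsAll-forest x 0 fits [] ≤-refl) (≤-reflexive (+-identityʳ _)))
    (≼-* x≼ (≼-* (≼-const 1 ≤-refl) (≼-* power≼ x≼)))
  length≼ : length (candidates c {b} {x} fits) ≼ 5
  length≼ = ≤-≼ (≤-trans (length-expandAll (startItems c {b} {x} fits) []) (≤-reflexive (+-identityʳ _))) visits≼
  search≼ : length (candidates c {b} {x} fits) * (7 + scanTime c (length (candidates c {b} {x} fits))) + 2 ≼ 23
  search≼ =
    ≼-+2 (≼-* length≼ (≼-+ (≼-const 3 7≤8)
    (≼-+2 (≼-* length≼ (≼-+ (≼-const 3 5≤8)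
    (≼-+ (≼-const 7 70≤128) (≼-+ (≼-* (≼-linear ≤-refl) (≼-const 5 30≤32)) (≼-* m≼ (≼-const 5 30≤32)))))))))
  total : totalTime c {b} {x} fits ≼ exponent
  total =
    (≼-+ (≼-const 3 5≤8) (≼-+ (≼-const 2 3≤4) (≼-+ (≼-+2 (≼-* k≼ (≼-const 5 20≤32)))
    (≼-+ (≼-const 1 ≤-refl) (≼-+ (≼-+2 (≼-* b≼ (≼-const 5 20≤32)))
    (≼-+ (≼-+2 (≼-* x≼ (≼-const 6 60≤64)))
    (≼-+ (≼-+2 (≼-* visits≼ (≼-const 7 100≤128)))
    (≼-+ (≼-const 1 ≤-refl) search≼))))))))

-- Assembly for a fixed d = b + 2

blockSize : ∀ k b → 2 * k + (2 + b) ∸ 2 ≡ k * 2 + b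
blockSize k b = trans
  (cong (_∸ 2) (trans (+-suc (2 * k) (suc b)) (cong suc (+-suc (2 * k) b))))
  (cong (_+ b) (*-comm 2 k))

-- A clash among the candidates must exist, for otherwise the `N` blocks would force (2 + `b`)`N`
-- colours. The run then ends with an answer.
solves : ∀ {n k m} b (c : Colouring n (suc k) m) N → N * (suc k * 2 + b) ≤ n → N ≤ n → m < (2 + b) * N →
         SolvesWithin (program (bruteForce b)) c (n ^ (exponent * (2 + b)))
-- Without a block the strict upper bound on `m` is 0.
solves {m = m} b c zero fit N≤n m<dN = contradiction (subst (m <_) (*-zeroʳ (2 + b)) m<dN) λ ()
solves {n} {k} {m} b c N@(suc _) fit N≤n m<dN = conclude (bruteForce-halts c {b} {n ∸ L} fits)
  where
  L = suc k * 2 + b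

  L≤n : L ≤ n
  L≤n = ≤-trans (m≤m+n L _) fit

  fits : Fits {n} {suc k} {b} 0 (n ∸ L)
  fits = trans (sym (+-assoc (suc k * 2) b (n ∸ L))) (m+[n∸m]≡n L≤n)

  xs : List (Vertex n (suc k))
  xs = candidates c {b} {n ∸ L} fits

  hits : ∀ {t y} a l → Tok t (suc k) b y → suc k * 2 + (b + (a + l)) ≡ n →
         Hit (replicate a false ++ (y ++ replicate l false)) xs
  hits a l tok eq = expandAll-hit (startItems c {b} {n ∸ L} fits) []
    (forest-reach a (n ∸ L) 0 a l fits [] tok
      (+-cancelˡ-≡ b _ _ (+-cancelˡ-≡ (suc k * 2) _ _ (trans eq (sym fits)))) refl)

  clash : Any (λ A → Any (Clash c A) xs) xs
  clash with any? (λ A → any? (clash? c A) xs) xs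
  ... | yes found   = found
  ... | no  noClash =
    contradiction (Blocks.manyColours {b = b} c xs N fit hits noClash) (<⇒≱ m<dN)

  m≤n² : m ≤ n * n
  -- Both factors of (2 + `b`)`N` are at most `n`, the first because 2 + `b` ≤ `L`.
  m≤n² = ≤-trans (<⇒≤ m<dN) (*-mono-≤ (≤-trans (+-monoˡ-≤ b (m≤m+n 2 (k * 2))) L≤n) N≤n)

  conclude : Halts (oracle c) (bruteForce b) (totalTime c {b} {n ∸ L} fits)
      (store (⌜ n ⌝ℕ ∙ ⌜ suc k ⌝ℕ) nil nil nil nil nil nil nil nil nil)
      (λ τ → ∃[ z ] (Any (λ A → Any (Clash c A) xs) xs → Answer c z) ×
        ∃[ js ] τ ≡ z ∷ js) →
    SolvesWithin (program (bruteForce b)) c (n ^ (exponent * (2 + b)))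
  conclude (_ , time , run , time≤ , z , find , js , refl) with find clash
  ... | edge , refl = record
    { edge     = edge
    ; time     = time
    ; computes = record { run = run }
    ; inTime   = ≤-trans time≤ (totalTime-bound c {b} {n ∸ L} fits m≤n²)
    }

theorem1p1 : ∃[ C ] (∀ (d : ℕ) (2≤d : 2 ≤ d) →
    ∃[ P ] (∀ (m : ℕ → ℕ → ℕ) (n k : ℕ) .{{_ : NonZero n}} .{{_ : NonZero k}} →
    2 * k ≤ n →
    m n k < d * (_/_ n (2 * k + d ∸ 2) {{blockSize-nonZero 2≤d}}) →
    (c : Colouring n k (m n k)) →
    SolvesWithin P c (n ^ (C * d))))
theorem1p1 = exponent , λ where
  (suc (suc b)) 2≤d@(s≤s (s≤s _)) → program (bruteForce b) , λ where
    m n (suc k) _ m<dN c →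
      let instance _ = blockSize-nonZero {suc (suc b)} {suc k} 2≤d
      in solves b c (n / (2 * suc k + suc (suc b) ∸ 2))
        (subst (λ L → n / (2 * suc k + suc (suc b) ∸ 2) * L ≤ n) (blockSize (suc k) b)
          (m/n*n≤m n (2 * suc k + suc (suc b) ∸ 2)))
        (m/n≤m n (2 * suc k + suc (suc b) ∸ 2)) m<dN
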